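{- Let $n\ge 3$ and let $\Gamma$ be a signed graph on the $2n$ vertices $V_1\cup V_2$, $V_1=\{u_1,\dots,u_n\}$, $V_2=\{v_1,\dots,v_n\}$, whose only edges are the positive edges of the path $u_1u_2\cdots u_n$ and the positive edges of the path $v_1v_2\cdots v_n$ (so there are no edges between $V_1$ and $V_2$). Let $\Gamma_1$ be obtained from $\Gamma$ by adding a positive edge $u_1u_n$, a negative edge $u_1v_1$ and a positive edge $u_1v_n$. Then: (i) $\Gamma_1$ and its partial transpose $\Gamma_1^{\tau}$ (with respect to the labelled partition $V_1,V_2$) are non-isomorphic and Laplacian cospectral; (ii) let $\Gamma_2$ be obtained from $\Gamma_1$ by changing the sign of the edge $u_{n-1}u_n$ to negative and the sign of the edge $u_1v_1$ to positive, and let $\Gamma_3$ be obtained from $\Gamma_1^{\tau}$ by changing the sign of the edge $u_{n-1}u_n$ to negative. Then $\Gamma_2$ and $\Gamma_3$ are non-isomorphic and Laplacian cospectral.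
   Context: A signed graph $\Gamma=(G,\sigma)$ is a simple graph $G$ with a sign function $\sigma:E(G)\to\{1,-1\}$. Its adjacency matrix $A(\Gamma)=(a_{ij})$ has $a_{ij}=\sigma(v_iv_j)$ if $v_iv_j\in E(G)$ and $0$ otherwise; its Laplacian matrix is $L(\Gamma)=D(G)-A(\Gamma)$, where $D(G)$ is the diagonal matrix of vertex degrees of $G$. Two signed graphs are Laplacian cospectral if their Laplacian matrices have the same spectrum (with multiplicities). Two signed graphs are isomorphic if there is an isomorphism of the underlying graphs preserving the signs of edges. Partial transpose: let $\Gamma$ be a signed graph whose vertex set is the disjoint union of $V_1=\{u_1,\dots,u_n\}$ and $V_2=\{v_1,\dots,v_n\}$ (with these labellings fixed). The partial transpose $\Gamma^{\tau}$ is the signed graph on the same vertex set in which all edges with both ends in $V_1$ or both ends in $V_2$ are kept with their signs, all edges between $V_1$ and $V_2$ are removed, and for every edge $u_iv_j$ of $\Gamma$ with sign $s$, an edge $u_jv_i$ with sign $s$ is added. (Thus $u_jv_i$ is an edge of $\Gamma^\tau$ with sign $s$ iff $u_iv_j$ is an edge of $\Gamma$ with sign $s$; edges $u_iv_i$ are unchanged.) -}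

module Defs where

open import Algebra.Apartness.Bundles using (HeytingField; HeytingCommutativeRing)
open import Algebra.Bundles using (CommutativeRing)
open import Algebra.Bundles.Raw using (RawRing)
import Algebra.Definitions.RawSemiring as SemiringDefs
open import Data.Bool.Base using (Bool; true; false; if_then_else_; _∧_; _∨_)
open import Data.Bool.Properties using (∧-comm; ∨-comm)
open import Data.Empty using (⊥-elim)
open import Data.Fin.Base
  using (Fin; zero; suc; toℕ; fromℕ; inject₁; punchIn; splitAt; _↑ˡ_; _↑ʳ_)
open import Data.Fin.Permutation using (Permutation; _⟨$⟩ʳ_)
open import Data.Fin.Properties using (_≟_; splitAt-↑ˡ; splitAt-↑ʳ; ↑ˡ-injective)
open import Data.List.Base using (List; []; _∷_; map; foldr)
open import Data.Maybe.Base as Maybe using (Maybe; just; nothing; is-just)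
open import Data.Nat.Base as ℕ using (ℕ; zero; suc; _≤_; z≤n; s≤s)
import Data.Nat.Properties as ℕₚ
open import Data.Product.Base using (Σ; ∃-syntax; _×_)
open import Data.Sign.Base using (Sign)
open import Data.Sum.Base using (_⊎_; inj₁; inj₂)
open import Data.Vec.Functional as Vector using ()
open import Function.Base using (const)
open import Function.Bundles using (_⇔_)
open import Level using (0ℓ)
open import Relation.Binary.PropositionalEquality
  using (_≡_; _≢_; refl; sym; trans; cong; cong₂)
open import Relation.Nullary using (yes; no; ⌊_⌋)

-- `edge x y` is `nothing` when x and y are not adjacent, and `just s`
-- when they are joined by an edge of sign s.
record SignedGraph (N : ℕ) : Set where
  field
    edge        : Fin N → Fin N → Maybe Sign
    edge-sym    : ∀ x y → edge x y ≡ edge y x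
    edge-irrefl : ∀ x → edge x x ≡ nothing

open SignedGraph public

infix 4 _≅_

_≅_ : ∀ {M N} → SignedGraph M → SignedGraph N → Set
_≅_ {M} {N} Γ Δ =
  Σ (Permutation M N) λ π →
    ∀ x y → edge Δ (π ⟨$⟩ʳ x) (π ⟨$⟩ʳ y) ≡ edge Γ x y

degree : ∀ {N} → SignedGraph N → Fin N → ℕ
degree Γ x =
  Vector.foldr ℕ._+_ 0 (λ y → if is-just (edge Γ x y) then 1 else 0)

Matrix : ∀ {a} → Set a → ℕ → Set a
Matrix A N = Fin N → Fin N → A

module _ {c ℓ} (R : RawRing c ℓ) where
  open RawRing R
  open SemiringDefs rawSemiring using (sum; _^_)

  det : ∀ {N} → Matrix Carrier N → Carrier
  det {zero}  M = 1#
  det {suc N} M =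
    sum λ j → (- 1#) ^ toℕ j * (M zero j * det (λ r k → M (suc r) (punchIn j k)))

module Polynomial {c ℓ} (R : RawRing c ℓ) where
  open RawRing R

  -- Coefficients in increasing degree; trailing zeros are allowed, so
  -- polynomials are compared coefficientwise.
  Poly : Set c
  Poly = List Carrier

  coeff : Poly → ℕ → Carrier
  coeff []      _       = 0#
  coeff (a ∷ p) zero    = a
  coeff (a ∷ p) (suc k) = coeff p k

  _+ₚ_ : Poly → Poly → Poly
  []      +ₚ q       = q
  (a ∷ p) +ₚ []      = a ∷ p
  (a ∷ p) +ₚ (b ∷ q) = (a + b) ∷ (p +ₚ q)

  _*ₚ_ : Poly → Poly → Poly
  []      *ₚ q = []
  (a ∷ p) *ₚ q = map (a *_) q +ₚ (0# ∷ (p *ₚ q))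

  polyRing : RawRing c ℓ
  polyRing = record
    { Carrier = Poly
    ; _≈_     = λ p q → ∀ k → coeff p k ≈ coeff q k
    ; _+_     = _+ₚ_
    ; _*_     = _*ₚ_
    ; -_      = map (-_)
    ; 0#      = []
    ; 1#      = 1# ∷ []
    }

  eval : Poly → Carrier → Carrier
  eval p x = foldr (λ a r → a + x * r) 0# p

  -- X − a
  X-_ : Carrier → Poly
  X- a = - a ∷ 1# ∷ []

  -- det (X I − M)
  charPoly : ∀ {N} → Matrix Carrier N → Poly
  charPoly M = det polyRing λ x y →
    if ⌊ x ≟ y ⌋ then X- (M x y) else (- M x y ∷ [])

module _ {c ℓ} (R : RawRing c ℓ) where
  open RawRing R
  open SemiringDefs rawSemiring using () renaming (_×_ to _·_)

  adjacency : ∀ {N} → SignedGraph N → Matrix Carrier N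
  adjacency Γ x y with edge Γ x y
  ... | nothing     = 0#
  ... | just Sign.+ = 1#
  ... | just Sign.- = - 1#

  degreeMatrix : ∀ {N} → SignedGraph N → Matrix Carrier N
  degreeMatrix Γ x y = if ⌊ x ≟ y ⌋ then degree Γ x · 1# else 0#

  laplacian : ∀ {N} → SignedGraph N → Matrix Carrier N
  laplacian Γ x y = degreeMatrix Γ x y + (- adjacency Γ x y)

fieldRawRing : ∀ {c ℓ₁ ℓ₂} → HeytingField c ℓ₁ ℓ₂ → RawRing c ℓ₁
fieldRawRing K =
  CommutativeRing.rawRing
    (HeytingCommutativeRing.commutativeRing (HeytingField.heytingCommutativeRing K))

module _ {c ℓ₁ ℓ₂} (K : HeytingField c ℓ₁ ℓ₂) where
  open HeytingField K using (Carrier; _#_; 0#; 1#)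
  open SemiringDefs (RawRing.rawSemiring (fieldRawRing K)) using () renaming (_×_ to _·_)
  open Polynomial (fieldRawRing K)
  open RawRing polyRing using (_≈_; _*_)
  open SemiringDefs (RawRing.rawSemiring polyRing) using (_^_)

  CharacteristicZero : Set ℓ₂
  CharacteristicZero = ∀ m → (suc m · 1#) # 0#

  -- a is a root of the characteristic polynomial of multiplicity exactly k;
  -- for k = 0 this says that a is not an eigenvalue.
  HasMultiplicity : ∀ {N} → Matrix Carrier N → Carrier → ℕ → Set _
  HasMultiplicity M a k =
    ∃[ q ] charPoly M ≈ ((X- a) ^ k) * q × eval q a # 0#

  SameSpectrum : ∀ {M N} → Matrix Carrier M → Matrix Carrier N → Set _
  SameSpectrum A B = ∀ a k → HasMultiplicity A a k ⇔ HasMultiplicity B a k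

-- There is no library type of real (or complex) numbers.  The eigenvalues,
-- with multiplicity, are required to agree in every field of characteristic
-- zero; this includes ℝ and ℂ, which are Heyting fields constructively.
LaplacianCospectral : ∀ {M N} → SignedGraph M → SignedGraph N → Set₁
LaplacianCospectral Γ Δ =
  (K : HeytingField 0ℓ 0ℓ 0ℓ) → CharacteristicZero K →
  SameSpectrum K (laplacian (fieldRawRing K) Γ) (laplacian (fieldRawRing K) Δ)

samePair : ∀ {N} → Fin N → Fin N → Fin N → Fin N → Bool
samePair x y a b = (⌊ a ≟ x ⌋ ∧ ⌊ b ≟ y ⌋) ∨ (⌊ a ≟ y ⌋ ∧ ⌊ b ≟ x ⌋)

samePair-sym : ∀ {N} (x y a b : Fin N) → samePair x y a b ≡ samePair x y b a
samePair-sym x y a b =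
  trans (∨-comm (⌊ a ≟ x ⌋ ∧ ⌊ b ≟ y ⌋) (⌊ a ≟ y ⌋ ∧ ⌊ b ≟ x ⌋))
        (cong₂ _∨_ (∧-comm ⌊ a ≟ y ⌋ ⌊ b ≟ x ⌋) (∧-comm ⌊ a ≟ x ⌋ ⌊ b ≟ y ⌋))

samePair-irrefl : ∀ {N} {x y : Fin N} → x ≢ y → ∀ a → samePair x y a a ≡ false
samePair-irrefl {x = x} {y} x≢y a with a ≟ x | a ≟ y
... | yes a≡x | yes a≡y = ⊥-elim (x≢y (trans (sym a≡x) a≡y))
... | yes _   | no _    = refl
... | no _    | yes _   = refl
... | no _    | no _    = refl

addEdge : ∀ {N} → SignedGraph N → (x y : Fin N) → x ≢ y → Sign → SignedGraph N
addEdge Γ x y x≢y s = record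
  { edge        = λ a b → if samePair x y a b then just s else edge Γ a b
  ; edge-sym    = λ a b → cong₂ (if_then just s else_) (samePair-sym x y a b) (edge-sym Γ a b)
  ; edge-irrefl = λ a → trans
      (cong (if_then just s else edge Γ a a) (samePair-irrefl x≢y a))
      (edge-irrefl Γ a)
  }

changeSign : ∀ {N} → SignedGraph N → (x y : Fin N) → Sign → SignedGraph N
changeSign {N} Γ x y s = record
  { edge        = λ a b → resign (samePair x y a b) (edge Γ a b)
  ; edge-sym    = λ a b → cong₂ resign (samePair-sym x y a b) (edge-sym Γ a b)
  ; edge-irrefl = λ a → trans
      (cong (resign (samePair x y a a)) (edge-irrefl Γ a))
      (resign-nothing (samePair x y a a))
  }
  where
  resign : Bool → Maybe Sign → Maybe Sign
  resign b e = if b then Maybe.map (const s) e else e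

  resign-nothing : ∀ b → resign b nothing ≡ nothing
  resign-nothing true  = refl
  resign-nothing false = refl

-- The vertices of a graph on Fin (n + n) are u 0, …, u (n-1), v 0, …, v (n-1).
u v : ∀ {n} → Fin n → Fin (n ℕ.+ n)
u {n} i = i ↑ˡ n
v {n} i = n ↑ʳ i

u-injective : ∀ {n} {i j : Fin n} → u i ≡ u j → i ≡ j
u-injective {n} {i} {j} = ↑ˡ-injective n i j

u≢v : ∀ {n} {i j : Fin n} → u i ≢ v j
u≢v {n} {i} {j} eq
  with trans (sym (splitAt-↑ˡ n i n)) (trans (cong (splitAt n) eq) (splitAt-↑ʳ n n j))
... | ()

transposedEdge : ∀ n → SignedGraph (n ℕ.+ n) → (x y : Fin n ⊎ Fin n) → Maybe Sign
transposedEdge n Γ (inj₁ i) (inj₁ j) = edge Γ (u i) (u j)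
transposedEdge n Γ (inj₁ i) (inj₂ j) = edge Γ (u j) (v i)
transposedEdge n Γ (inj₂ i) (inj₁ j) = edge Γ (u i) (v j)
transposedEdge n Γ (inj₂ i) (inj₂ j) = edge Γ (v i) (v j)

transposedEdge-sym : ∀ n (Γ : SignedGraph (n ℕ.+ n)) x y →
                     transposedEdge n Γ x y ≡ transposedEdge n Γ y x
transposedEdge-sym n Γ (inj₁ i) (inj₁ j) = edge-sym Γ (u i) (u j)
transposedEdge-sym n Γ (inj₁ i) (inj₂ j) = refl
transposedEdge-sym n Γ (inj₂ i) (inj₁ j) = refl
transposedEdge-sym n Γ (inj₂ i) (inj₂ j) = edge-sym Γ (v i) (v j)

transposedEdge-irrefl : ∀ n (Γ : SignedGraph (n ℕ.+ n)) x →
                        transposedEdge n Γ x x ≡ nothing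
transposedEdge-irrefl n Γ (inj₁ i) = edge-irrefl Γ (u i)
transposedEdge-irrefl n Γ (inj₂ i) = edge-irrefl Γ (v i)

partialTranspose : ∀ n → SignedGraph (n ℕ.+ n) → SignedGraph (n ℕ.+ n)
partialTranspose n Γ = record
  { edge        = λ x y → transposedEdge n Γ (splitAt n x) (splitAt n y)
  ; edge-sym    = λ x y → transposedEdge-sym n Γ (splitAt n x) (splitAt n y)
  ; edge-irrefl = λ x → transposedEdge-irrefl n Γ (splitAt n x)
  }

pathEdge : ∀ {n} → Fin n → Fin n → Maybe Sign
pathEdge i j =
  if ⌊ suc (toℕ i) ℕₚ.≟ toℕ j ⌋ ∨ ⌊ suc (toℕ j) ℕₚ.≟ toℕ i ⌋
  then just Sign.+ else nothing

pathEdge-sym : ∀ {n} (i j : Fin n) → pathEdge i j ≡ pathEdge j i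
pathEdge-sym i j = cong (if_then just Sign.+ else nothing)
  (∨-comm ⌊ suc (toℕ i) ℕₚ.≟ toℕ j ⌋ ⌊ suc (toℕ j) ℕₚ.≟ toℕ i ⌋)

pathEdge-irrefl : ∀ {n} (i : Fin n) → pathEdge i i ≡ nothing
pathEdge-irrefl i with suc (toℕ i) ℕₚ.≟ toℕ i
... | yes eq = ⊥-elim (ℕₚ.1+n≢n eq)
... | no  _  = refl

twoPathsEdge : ∀ {n} → (x y : Fin n ⊎ Fin n) → Maybe Sign
twoPathsEdge (inj₁ i) (inj₁ j) = pathEdge i j
twoPathsEdge (inj₂ i) (inj₂ j) = pathEdge i j
twoPathsEdge (inj₁ _) (inj₂ _) = nothing
twoPathsEdge (inj₂ _) (inj₁ _) = nothing

twoPathsEdge-sym : ∀ {n} (x y : Fin n ⊎ Fin n) → twoPathsEdge x y ≡ twoPathsEdge y x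
twoPathsEdge-sym (inj₁ i) (inj₁ j) = pathEdge-sym i j
twoPathsEdge-sym (inj₂ i) (inj₂ j) = pathEdge-sym i j
twoPathsEdge-sym (inj₁ _) (inj₂ _) = refl
twoPathsEdge-sym (inj₂ _) (inj₁ _) = refl

twoPathsEdge-irrefl : ∀ {n} (x : Fin n ⊎ Fin n) → twoPathsEdge x x ≡ nothing
twoPathsEdge-irrefl (inj₁ i) = pathEdge-irrefl i
twoPathsEdge-irrefl (inj₂ i) = pathEdge-irrefl i

twoPaths : ∀ n → SignedGraph (n ℕ.+ n)
twoPaths n = record
  { edge        = λ x y → twoPathsEdge (splitAt n x) (splitAt n y)
  ; edge-sym    = λ x y → twoPathsEdge-sym (splitAt n x) (splitAt n y)
  ; edge-irrefl = λ x → twoPathsEdge-irrefl (splitAt n x)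
  }

first last penultimate : ∀ {n} → 3 ≤ n → Fin n
first       (s≤s _)                   = zero
last        (s≤s {n = m} _)           = fromℕ m
penultimate (s≤s (s≤s {n = m} _))     = inject₁ (fromℕ m)

first≢last : ∀ {n} (n≥3 : 3 ≤ n) → first n≥3 ≢ last n≥3
first≢last (s≤s (s≤s _)) ()

module _ {n : ℕ} (n≥3 : 3 ≤ n) where

  u₁ uₙ₋₁ uₙ v₁ vₙ : Fin (n ℕ.+ n)
  u₁   = u (first n≥3)
  uₙ₋₁ = u (penultimate n≥3)
  uₙ   = u (last n≥3)
  v₁   = v (first n≥3)
  vₙ   = v (last n≥3)

  Γ₁ : SignedGraph (n ℕ.+ n)
  Γ₁ = addEdge (addEdge (addEdge (twoPaths n)
         u₁ uₙ (λ eq → first≢last n≥3 (u-injective eq)) Sign.+)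
         u₁ v₁ u≢v Sign.-)
         u₁ vₙ u≢v Sign.+

  Γ₁τ : SignedGraph (n ℕ.+ n)
  Γ₁τ = partialTranspose n Γ₁

  Γ₂ : SignedGraph (n ℕ.+ n)
  Γ₂ = changeSign (changeSign Γ₁ uₙ₋₁ uₙ Sign.-) u₁ v₁ Sign.+

  Γ₃ : SignedGraph (n ℕ.+ n)
  Γ₃ = changeSign Γ₁τ uₙ₋₁ uₙ Sign.-

{-# OPTIONS --safe #-}

-- On functions on the two paths let J be the reversal of both paths.  The Laplacian T ⊕ T of
-- the two paths commutes with every operator of the form α ⊗ I + β ⊗ J, where α and β are
-- 2 × 2 matrices mixing the paths.  The added edges contribute rank-one terms supported on
-- the four end vertices u₁, uₙ, v₁, vₙ.  In the basis of symmetric and antisymmetric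
-- combinations of the ends of each path, the contributions in Γ₁ and Γ₁τ differ by the
-- exchange of the two symmetric vectors, and this exchange has the form α ⊗ I + β ⊗ J.  For
-- (ii), switching at uₙ makes both paths positive again in Γ₂ and Γ₃; then the antisymmetric
-- vectors are exchanged and the symmetric vector of the path v is negated.  These operators
-- are involutions (over a field of characteristic ≠ 2), so the Laplacians are similar and
-- have the same characteristic polynomial.
--
-- The graphs are not isomorphic because vₙ has degree 1 in Γ₁τ and Γ₃, whereas every vertex
-- of Γ₁ and Γ₂ has degree at least 2.

module Submission where

open import Defs
open import Algebra.Apartness.Bundles using (HeytingField; HeytingCommutativeRing)
open import Algebra.Bundles using (CommutativeRing)
open import Algebra.Bundles.Raw using (RawRing)
import Algebra.Definitions.RawSemiring as SemiringDefs
open import Algebra.Morphism.Structures using (IsSemiringHomomorphism)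
import Algebra.Properties.AbelianGroup as AbelianGroupProperties
import Algebra.Properties.Ring as RingProperties
import Algebra.Properties.Semiring.Mult.TCOptimised as Multiples
import Algebra.Properties.Semiring.Sum as SemiringSum
import Algebra.Solver.Ring
open import Algebra.Solver.Ring.AlmostCommutativeRing
  using (fromCommutativeRing; _-Raw-AlmostCommutative⟶_; Induced-equivalence)
open import Data.Bool.Base using (Bool; true; false; if_then_else_; _xor_; _∧_; _∨_)
open import Data.Bool.Properties using (xor-comm; ∧-comm; ∧-zeroʳ; ∨-identityʳ)
open import Data.Fin.Base
  using (Fin; zero; suc; toℕ; fromℕ; fromℕ<; inject₁; lift; opposite; punchIn; splitAt; _↑ˡ_; _↑ʳ_)
open import Data.Fin.Permutation using (reverse; _⟨$⟩ʳ_; _⟨$⟩ˡ_; inverseʳ; inverseˡ)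
open import Data.Fin.Properties
  using (_≟_; fromℕ≢inject₁; join-splitAt; opposite-involutive; opposite-prop; splitAt-↑ˡ;
         splitAt-↑ʳ; toℕ<n; toℕ-fromℕ; toℕ-fromℕ<; toℕ-inject₁; toℕ-injective; ↑ʳ-injective)
open import Data.Integer.Base as ℤ using (ℤ; +_; -[1+_]; _⊖_)
import Data.Integer.Properties as ℤₚ
open import Data.List.Base using (List; []; _∷_)
open import Data.Maybe.Base as Maybe using (Maybe; just; nothing; is-just)
open import Data.Nat.Base as ℕ using (ℕ; zero; suc; _≤_; s≤s)
import Data.Nat.Properties as ℕₚ
open import Data.Product.Base using (∃; ∃₂; _×_; _,_; proj₂)
open import Data.Sign.Base as Sign using (Sign)
open import Data.Sum.Base using (_⊎_; inj₁; inj₂; [_,_]′)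
import Data.Vec.Functional as Vector
open import Function.Base using (_∘_; const; id)
open import Function.Bundles using (mk⇔)
open import Level using (0ℓ; _⊔_)
open import Relation.Binary.Definitions using (WeaklyDecidable)
import Relation.Binary.PropositionalEquality as ≡
open ≡ using (_≡_; _≢_)
import Relation.Binary.Reasoning.Setoid as SetoidReasoning
open import Relation.Nullary using (¬_; yes; no; ⌊_⌋; Dec; contradiction)

-- Let `s`, `d` be the sum and the difference of the values at the ends of the path u, and `s'`,
-- `d'` those for v, and put `q = (s² + d² + s'² + d'²)/2`. The three added edges have the quadratic
-- form `d² + q + dd' + s(d + d')` in Γ₁ and `d² + q + dd' + s'(d + d')` in Γ₁τ, which shows the
-- exchange of `s` and `s'`. For (ii), after switching, the forms are `s² + q + sd - s'(s + d)` and
-- `s² + q + sd' + s'(s + d')`; hence the exchange of `d` and `d'` together with the sign of `s'`.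
-- Twice each involution has blocks `± I ± J` and square 4, so the only division is by 4. Similarity
-- is stated as `P A = B P`: each of its four blocks is then a polynomial identity in six ring
-- elements, the same for every `n`, which a ring solver can decide. The passage from similarity to
-- characteristic polynomials rests on multiplicativity of a determinant defined by expansion along
-- row 0. It is proved over any commutative ring, so that it also holds for polynomial entries, from
-- the fact that an alternating form is determined up to a factor, the determinant.

-- A ring solver with integer coefficients

module IntegerCoefficients {c ℓ} (R : CommutativeRing c ℓ) where
  open CommutativeRing R
  open RingProperties ring
  open AbelianGroupProperties +-abelianGroup using (⁻¹-∙-comm)
  -- With these multiples `1 · 1#` reduces to `1#`, so the solver constant `:1` denotes `1#` itself
  -- and solver equations match goals literally.
  open Multiples semiring renaming (_×_ to _·_)
  open SetoidReasoning setoid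

  fromℤ : ℤ → Carrier
  fromℤ (+ n)    = n · 1#
  fromℤ -[1+ n ] = - (suc n · 1#)

  private
    cancel : ∀ x y z → x + y - (x + z) ≈ y - z
    cancel x y z = begin
      x + y - (x + z)       ≈⟨ +-congˡ (⁻¹-∙-comm x z) ⟨
      x + y + (- x + - z)   ≈⟨ +-congʳ (+-comm x y) ⟩
      y + x + (- x + - z)   ≈⟨ +-assoc y x _ ⟩
      y + (x + (- x + - z)) ≈⟨ +-congˡ (+-assoc x (- x) (- z)) ⟨
      y + (x - x + - z)     ≈⟨ +-congˡ (+-congʳ (-‿inverseʳ x)) ⟩
      y + (0# + - z)        ≈⟨ +-congˡ (+-identityˡ (- z)) ⟩
      y - z                 ∎

  fromℤ-⊖ : ∀ m n → fromℤ (m ⊖ n) ≈ m · 1# - n · 1#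
  fromℤ-⊖ zero    zero    = sym (-‿inverseʳ 0#)
  fromℤ-⊖ zero    (suc n) = sym (+-identityˡ _)
  fromℤ-⊖ (suc m) zero    = sym (trans (+-congˡ -0#≈0#) (+-identityʳ _))
  fromℤ-⊖ (suc m) (suc n) = begin
    fromℤ (suc m ⊖ suc n)             ≡⟨ ≡.cong fromℤ (ℤₚ.[1+m]⊖[1+n]≡m⊖n m n) ⟩
    fromℤ (m ⊖ n)                     ≈⟨ fromℤ-⊖ m n ⟩
    m · 1# - n · 1#                   ≈⟨ cancel 1# (m · 1#) (n · 1#) ⟨
    1# + m · 1# - (1# + n · 1#)       ≈⟨ +-cong (1+× m 1#) (-‿cong (1+× n 1#)) ⟨
    suc m · 1# - suc n · 1#           ∎

  fromℤ-neg : ∀ i → fromℤ (ℤ.- i) ≈ - fromℤ i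
  fromℤ-neg (+ zero)  = sym -0#≈0#
  fromℤ-neg (+ suc n) = refl
  fromℤ-neg -[1+ n ]  = sym (-‿involutive _)

  fromℤ-+ : ∀ i j → fromℤ (i ℤ.+ j) ≈ fromℤ i + fromℤ j
  fromℤ-+ (+ m)    (+ n)    = ×-homo-+ 1# m n
  fromℤ-+ (+ m)    -[1+ n ] = fromℤ-⊖ m (suc n)
  fromℤ-+ -[1+ m ] (+ n)    = trans (fromℤ-⊖ n (suc m)) (+-comm _ _)
  fromℤ-+ -[1+ m ] -[1+ n ] = begin
    fromℤ (-[1+ m ] ℤ.+ -[1+ n ])  ≡⟨ ≡.cong fromℤ (ℤₚ.neg-distrib-+ (+ suc m) (+ suc n)) ⟨
    - ((suc m ℕ.+ suc n) · 1#)     ≈⟨ -‿cong (×-homo-+ 1# (suc m) (suc n)) ⟩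
    - (suc m · 1# + suc n · 1#)    ≈⟨ ⁻¹-∙-comm _ _ ⟨
    - (suc m · 1#) - suc n · 1#    ∎

  fromℤ-*-pos : ∀ m n → fromℤ (+ m ℤ.* + n) ≈ m · 1# * (n · 1#)
  fromℤ-*-pos m n = trans (reflexive (≡.cong fromℤ (≡.sym (ℤₚ.pos-* m n)))) (×1-homo-* m n)

  fromℤ-*-nonNeg : ∀ m j → fromℤ (+ m ℤ.* j) ≈ m · 1# * fromℤ j
  fromℤ-*-nonNeg m (+ n)    = fromℤ-*-pos m n
  fromℤ-*-nonNeg m -[1+ n ] = begin
    fromℤ (+ m ℤ.* -[1+ n ])        ≡⟨ ≡.cong fromℤ (ℤₚ.neg-distribʳ-* (+ m) (+ suc n)) ⟨
    fromℤ (ℤ.- (+ m ℤ.* + suc n))   ≈⟨ fromℤ-neg (+ m ℤ.* + suc n) ⟩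
    - fromℤ (+ m ℤ.* + suc n)       ≈⟨ -‿cong (fromℤ-*-pos m (suc n)) ⟩
    - (m · 1# * (suc n · 1#))       ≈⟨ -‿distribʳ-* _ _ ⟩
    m · 1# * - (suc n · 1#)         ∎

  fromℤ-* : ∀ i j → fromℤ (i ℤ.* j) ≈ fromℤ i * fromℤ j
  fromℤ-* (+ m)    j = fromℤ-*-nonNeg m j
  fromℤ-* -[1+ m ] j = begin
    fromℤ (-[1+ m ] ℤ.* j)          ≡⟨ ≡.cong fromℤ (ℤₚ.neg-distribˡ-* (+ suc m) j) ⟨
    fromℤ (ℤ.- (+ suc m ℤ.* j))     ≈⟨ fromℤ-neg (+ suc m ℤ.* j) ⟩
    - fromℤ (+ suc m ℤ.* j)         ≈⟨ -‿cong (fromℤ-*-nonNeg (suc m) j) ⟩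
    - (suc m · 1# * fromℤ j)        ≈⟨ -‿distribˡ-* _ _ ⟩
    - (suc m · 1#) * fromℤ j        ∎

  fromℤ-morphism : CommutativeRing.rawRing ℤₚ.+-*-commutativeRing
                   -Raw-AlmostCommutative⟶ fromCommutativeRing R
  fromℤ-morphism = record
    { ⟦_⟧    = fromℤ
    ; +-homo = fromℤ-+
    ; *-homo = fromℤ-*
    ; -‿homo = fromℤ-neg
    ; 0-homo = refl
    ; 1-homo = refl
    }

  -- Equality in `R` need not be decidable; comparing the integers before they are mapped to `R` is
  -- sound and lets the solver cancel coefficients.
  fromℤ-≟ : WeaklyDecidable (Induced-equivalence fromℤ-morphism)
  fromℤ-≟ i j with i ℤₚ.≟ j
  ... | yes i≡j = just (reflexive (≡.cong fromℤ i≡j))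
  ... | no  _   = nothing

module RingSolver {c ℓ} (R : CommutativeRing c ℓ) where
  open IntegerCoefficients R using (fromℤ-morphism; fromℤ-≟)
  open Algebra.Solver.Ring _ _ fromℤ-morphism fromℤ-≟ public
    using (solve; _:=_; _:+_; _:*_; :-_; _:-_; con; Polynomial)

  :0 :1 : ∀ {n} → Polynomial n
  :0 = con (+ 0)
  :1 = con (+ 1)

  -- Allows a formula parametrised by a raw ring to be read both in `R` and as solver syntax,
  -- without being written twice.
  syntaxRing : ℕ → RawRing _ _
  syntaxRing n = record
    { Carrier = Polynomial n
    ; _≈_     = _≡_
    ; _+_     = _:+_
    ; _*_     = _:*_
    ; -_      = :-_
    ; 0#      = :0
    ; 1#      = :1
    }

-- Determinants

module Determinants {c ℓ} (R : CommutativeRing c ℓ) where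
  open Vector using () renaming (_∷_ to infixr 5 _◁_)
  open CommutativeRing R hiding (zero)
  open RingProperties ring
  open SemiringDefs (RawRing.rawSemiring rawRing) using (_^_)
  open SemiringSum semiring
  open RingSolver R
  open SetoidReasoning setoid

  sgn : ∀ {n} → Fin n → Carrier
  sgn j = (- 1#) ^ toℕ j

  infix 4 _≋_
  _≋_ : ∀ {M N} → (Fin M → Fin N → Carrier) → (Fin M → Fin N → Carrier) → Set ℓ
  A ≋ B = ∀ r k → A r k ≈ B r k

  sum-zero : ∀ {n} {f : Fin n → Carrier} → (∀ i → f i ≈ 0#) → sum f ≈ 0#
  sum-zero {n} f≈0 = trans (sum-cong-≋ f≈0) (sum-replicate-zero n)

  det-cong : ∀ {N} {A B : Matrix Carrier N} → A ≋ B → det rawRing A ≈ det rawRing B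
  det-cong {zero}  A≋B = refl
  det-cong {suc N} A≋B = sum-cong-≋ λ j →
    *-congˡ {sgn j} (*-cong (A≋B zero j) (det-cong λ r k → A≋B (suc r) (punchIn j k)))

  module _ {K : ℕ} where

    Vec : Set c
    Vec = Fin K → Carrier

    -- The length `K` of the vectors is independent of the number `N` of arguments, because fixing
    -- the first argument lowers `N` only.
    Form : ℕ → Set c
    Form N = (Fin N → Vec) → Carrier

    Congruent : ∀ {N} → Form N → Set (c ⊔ ℓ)
    Congruent D = ∀ {w w'} → w ≋ w' → D w ≈ D w'

    LinearInHead : ∀ {N} → Form (suc N) → Set (c ⊔ ℓ)
    LinearInHead D = ∀ a x y z →
      D ((λ k → a * x k + y k) ◁ z) ≈ a * D (x ◁ z) + D (y ◁ z)

    -- Equal arguments are required to give 0 only when they come first, but this is imposed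
    -- after fixing any initial segment of arguments.
    data VanishesOnEqualHeads : ∀ {N} → Form (suc N) → Set (c ⊔ ℓ) where
      single : ∀ {D : Form 1} → VanishesOnEqualHeads D
      double : ∀ {N} {D : Form (suc (suc N))} →
               (∀ x z → D (x ◁ x ◁ z) ≈ 0#) → VanishesOnEqualHeads D

    data Alternating : ∀ {N} → Form N → Set (c ⊔ ℓ) where
      nil  : ∀ {D : Form 0} → Congruent D → Alternating D
      cons : ∀ {N} {D : Form (suc N)} → Congruent D → LinearInHead D →
             VanishesOnEqualHeads D → (∀ x → Alternating (λ z → D (x ◁ z))) →
             Alternating D

    congruent : ∀ {N} {D : Form N} → Alternating D → Congruent D
    congruent (nil cong)        = cong
    congruent (cons cong _ _ _) = cong

    ◁-≋ : ∀ {N} {x y : Vec} {z w : Fin N → Vec} →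
          (∀ k → x k ≈ y k) → z ≋ w → (x ◁ z) ≋ (y ◁ w)
    ◁-≋ x≈y z≋w zero    = x≈y
    ◁-≋ x≈y z≋w (suc r) = z≋w r

    ◁-head-tail : ∀ {N} (w : Fin (suc N) → Vec) → w ≋ (w zero ◁ (λ r → w (suc r)))
    ◁-head-tail w zero    k = refl
    ◁-head-tail w (suc r) k = refl

    module _ {N} {D : Form (suc N)} (cong : Congruent D) (lin : LinearInHead D) where

      -- Taking the scalar `- 1#` and two zero vectors in the linearity law makes the right-hand
      -- side cancel.
      head-zero : ∀ z → D ((λ _ → 0#) ◁ z) ≈ 0#
      head-zero z = begin
        D ((λ _ → 0#) ◁ z)
          ≈⟨ cong (◁-≋ (λ _ → solve 0 (:0 := :- :1 :* :0 :+ :0) refl) λ _ _ → refl) ⟩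
        D ((λ _ → - 1# * 0# + 0#) ◁ z)
          ≈⟨ lin (- 1#) (λ _ → 0#) (λ _ → 0#) z ⟩
        - 1# * D ((λ _ → 0#) ◁ z) + D ((λ _ → 0#) ◁ z)
          ≈⟨ solve 1 (λ d → :- :1 :* d :+ d := :0) refl _ ⟩
        0# ∎

      head-+ : ∀ x y z → D ((λ k → x k + y k) ◁ z) ≈ D (x ◁ z) + D (y ◁ z)
      head-+ x y z = begin
        D ((λ k → x k + y k) ◁ z)
          ≈⟨ cong (◁-≋ (λ k → +-congʳ (sym (*-identityˡ (x k)))) λ _ _ → refl) ⟩
        D ((λ k → 1# * x k + y k) ◁ z)
          ≈⟨ lin 1# x y z ⟩
        1# * D (x ◁ z) + D (y ◁ z)
          ≈⟨ +-congʳ (*-identityˡ _) ⟩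
        D (x ◁ z) + D (y ◁ z) ∎

      head-sum : ∀ {M} (a : Fin M → Carrier) (w : Fin M → Vec) z →
                 D ((λ k → sum λ j → a j * w j k) ◁ z) ≈ sum λ j → a j * D (w j ◁ z)
      head-sum {zero}  a w z = head-zero z
      head-sum {suc M} a w z = trans (lin (a zero) (w zero) _ z)
        (+-congˡ (head-sum (λ j → a (suc j)) (λ j → w (suc j)) z))

    -- Polarisation: expand the value at two equal heads `x + y`, which is 0.
    swap-heads : ∀ {N} {D : Form (suc (suc N))} → Alternating D →
                 ∀ x y z → D (x ◁ y ◁ z) ≈ - D (y ◁ x ◁ z)
    swap-heads {D = D} (cons cong lin (double vanish) alt) x y z = begin
      D (x ◁ y ◁ z)
        ≈⟨ solve 2 (λ p q → p := :0 :+ p :+ (q :+ :0) :- q) refl _ _ ⟩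
      0# + D (x ◁ y ◁ z) + (D (y ◁ x ◁ z) + 0#) - D (y ◁ x ◁ z)
        ≈⟨ +-congʳ (+-cong (+-congʳ (vanish x z)) (+-congˡ (vanish y z))) ⟨
      D (x ◁ x ◁ z) + D (x ◁ y ◁ z) + (D (y ◁ x ◁ z) + D (y ◁ y ◁ z)) - D (y ◁ x ◁ z)
        ≈⟨ +-congʳ (+-cong (second-+ x) (second-+ y)) ⟨
      D (x ◁ x+y ◁ z) + D (y ◁ x+y ◁ z) - D (y ◁ x ◁ z)
        ≈⟨ +-congʳ (head-+ cong lin x y (x+y ◁ z)) ⟨
      D (x+y ◁ x+y ◁ z) - D (y ◁ x ◁ z)
        ≈⟨ +-congʳ (vanish x+y z) ⟩
      0# - D (y ◁ x ◁ z)
        ≈⟨ +-identityˡ _ ⟩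
      - D (y ◁ x ◁ z) ∎
      where
      x+y : Vec
      x+y k = x k + y k

      second-+ : ∀ t → D (t ◁ x+y ◁ z) ≈ D (t ◁ x ◁ z) + D (t ◁ y ◁ z)
      second-+ t with alt t
      ... | cons cong' lin' _ _ = head-+ cong' lin' x y z

    -- One swap puts `y zero` in front of `x`. With `y zero` fixed, the copy of `x` is one place
    -- closer to it.
    vanishes : ∀ {N} {D : Form (suc N)} → Alternating D → ∀ x y r →
               (∀ k → y r k ≈ x k) → D (x ◁ y) ≈ 0#
    vanishes (cons cong lin (double vanish) alt) x y zero y≈x = trans
      (cong (◁-≋ (λ _ → refl) λ r k → trans (◁-head-tail y r k)
              (◁-≋ y≈x (λ _ _ → refl) r k)))
      (vanish x (λ r → y (suc r)))
    vanishes {D = D} A@(cons cong lin _ alt) x y (suc r) y≈x = begin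
      D (x ◁ y)
        ≈⟨ cong (◁-≋ (λ _ → refl) (◁-head-tail y)) ⟩
      D (x ◁ y zero ◁ (λ r → y (suc r)))
        ≈⟨ swap-heads A x (y zero) _ ⟩
      - D (y zero ◁ x ◁ (λ r → y (suc r)))
        ≈⟨ -‿cong (vanishes (alt (y zero)) x (λ r → y (suc r)) r y≈x) ⟩
      - 0#
        ≈⟨ -0#≈0# ⟩
      0# ∎

    -- Row operations with a row outside the argument list: `D` is meant to be an alternating form
    -- whose first argument has already been fixed to `x`, so any further `x` gives 0.
    shear : ∀ {N} {D : Form N} → Alternating D → ∀ (x : Vec) →
            (∀ (y : Fin N → Vec) r → (∀ k → y r k ≈ x k) → D y ≈ 0#) →
            ∀ (a : Fin N → Carrier) (y : Fin N → Vec) → D (λ r k → a r * x k + y r k) ≈ D y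
    shear (nil cong) x vanish a y = cong λ ()
    shear {D = D} (cons cong lin _ alt) x vanish a y = begin
      D (λ r k → a r * x k + y r k)
        ≈⟨ cong (◁-head-tail _) ⟩
      D ((λ k → a zero * x k + y zero k) ◁ rest)
        ≈⟨ lin (a zero) x (y zero) rest ⟩
      a zero * D (x ◁ rest) + D (y zero ◁ rest)
        ≈⟨ +-cong (*-congˡ (vanish (x ◁ rest) zero λ _ → refl))
                  (shear (alt (y zero)) x (λ z r → vanish (y zero ◁ z) (suc r))
                         (λ r → a (suc r)) (λ r → y (suc r))) ⟩
      a zero * 0# + D (y zero ◁ (λ r → y (suc r)))
        ≈⟨ trans (+-congʳ (zeroʳ _)) (+-identityˡ _) ⟩
      D (y zero ◁ (λ r → y (suc r)))
        ≈⟨ cong (◁-head-tail y) ⟨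
      D y ∎
      where
      rest : Fin _ → Vec
      rest r k = a (suc r) * x k + y (suc r) k

    -- The argument `w j` passes `j` others, each at the cost of one sign; after the exchange with
    -- `w zero`, the latter is fixed and the induction runs on the rest.
    move-to-head : ∀ {N} {D : Form (suc N)} → Alternating D → ∀ w j →
                   D (w j ◁ (λ r → w (punchIn j r))) ≈ sgn j * D w
    move-to-head (cons cong _ _ _) w zero =
      trans (sym (cong (◁-head-tail w))) (sym (*-identityˡ _))
    move-to-head {N = suc N} {D} A@(cons cong _ _ alt) w (suc j) = begin
      D (w (suc j) ◁ (λ r → w (punchIn (suc j) r)))
        ≈⟨ cong (◁-≋ (λ _ → refl) (◁-head-tail _)) ⟩
      D (w (suc j) ◁ w zero ◁ (λ r → w (suc (punchIn j r))))
        ≈⟨ swap-heads A (w (suc j)) (w zero) _ ⟩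
      - D (w zero ◁ w (suc j) ◁ (λ r → w (suc (punchIn j r))))
        ≈⟨ -‿cong (cong (◁-≋ (λ _ → refl) λ { zero _ → refl ; (suc r) _ → refl })) ⟩
      - D (w zero ◁ (w (suc j) ◁ (λ r → w (suc (punchIn j r)))))
        ≈⟨ -‿cong (move-to-head (alt (w zero)) (λ r → w (suc r)) j) ⟩
      - (sgn j * D (w zero ◁ (λ r → w (suc r))))
        ≈⟨ -‿cong (*-congˡ (cong (◁-head-tail w))) ⟨
      - (sgn j * D w)
        ≈⟨ solve 2 (λ s d → :- (s :* d) := :- :1 :* s :* d) refl _ _ ⟩
      - 1# * sgn j * D w ∎

    -- Once row 0 of A is expanded, the form D (w j ◁ –) does not see the w j components of
    -- the other rows, and what remains of those rows is the j-th minor.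
    alternating-det : ∀ {N} {D : Form N} → Alternating D →
                      ∀ (A : Matrix Carrier N) (w : Fin N → Vec) →
                      D (λ r k → sum λ j → A r j * w j k) ≈ det rawRing A * D w
    alternating-det (nil cong) A w = trans (cong λ ()) (sym (*-identityˡ _))
    alternating-det {suc N} {D} alternating@(cons cong lin _ alt) A w = begin
      D (λ r k → sum λ j → A r j * w j k)
        ≈⟨ cong (◁-head-tail _) ⟩
      D ((λ k → sum λ j → A zero j * w j k) ◁ rest)
        ≈⟨ head-sum cong lin (A zero) w rest ⟩
      (sum λ j → A zero j * D (w j ◁ rest))
        ≈⟨ sum-cong-≋ term ⟩
      (sum λ j → sgn j * (A zero j * det rawRing (minor j)) * D w)
        ≈⟨ *-distribʳ-sum (D w) (λ j → sgn j * (A zero j * det rawRing (minor j))) ⟨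
      det rawRing A * D w ∎
      where
      rest : Fin N → Vec
      rest r k = sum λ j → A (suc r) j * w j k

      minor : Fin (suc N) → Matrix Carrier N
      minor j r k = A (suc r) (punchIn j k)

      term : ∀ j → A zero j * D (w j ◁ rest) ≈
                   sgn j * (A zero j * det rawRing (minor j)) * D w
      term j = begin
        A zero j * D (w j ◁ rest)
          ≈⟨ *-congˡ (cong (◁-≋ (λ _ → refl) λ r k → sum-remove {i = j} (λ i → A (suc r) i * w i k))) ⟩
        A zero j * D (w j ◁ λ r k → A (suc r) j * w j k +
                            sum λ i → minor j r i * w (punchIn j i) k)
          ≈⟨ *-congˡ (shear (alt (w j)) (w j) (vanishes alternating (w j))
                            (λ r → A (suc r) j) (λ r k → sum λ i → minor j r i * w (punchIn j i) k)) ⟩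
        A zero j * D (w j ◁ λ r k → sum λ i → minor j r i * w (punchIn j i) k)
          ≈⟨ *-congˡ (alternating-det (alt (w j)) (minor j) (λ r → w (punchIn j r))) ⟩
        A zero j * (det rawRing (minor j) * D (w j ◁ λ r → w (punchIn j r)))
          ≈⟨ *-congˡ (*-congˡ (move-to-head alternating w j)) ⟩
        A zero j * (det rawRing (minor j) * (sgn j * D w))
          ≈⟨ solve 4 (λ a m s d → a :* (m :* (s :* d)) := s :* (a :* m) :* d) refl _ _ _ _ ⟩
        sgn j * (A zero j * det rawRing (minor j)) * D w ∎

    -- The shape of a cofactor expansion with its first row fixed: `s` will be the signs, `t` the
    -- entries of that row and `D` the minors as forms in the remaining rows.
    alternating-sum : ∀ {N M} {D : Fin M → Form N} → (∀ j → Alternating (D j)) →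
                      ∀ (s t : Fin M → Carrier) →
                      Alternating (λ w → sum λ j → s j * (t j * D j w))
    alternating-sum {zero} alt s t =
      nil λ w≋w' → sum-cong-≋ λ j → *-congˡ {s j} (*-congˡ (congruent (alt j) w≋w'))
    alternating-sum {suc N} {M} {D} alt s t = cons
      (λ w≋w' → sum-cong-≋ λ j → *-congˡ {s j} (*-congˡ (congruent (alt j) w≋w')))
      linear
      (equal-heads N D alt)
      (λ x → alternating-sum (λ j → tails x (alt j)) s t)
      where
      tails : ∀ {N} {D : Form (suc N)} x → Alternating D → Alternating (λ z → D (x ◁ z))
      tails x (cons _ _ _ alt) = alt x

      linear : LinearInHead (λ w → sum λ j → s j * (t j * D j w))
      linear a x y z = begin
        (sum λ j → s j * (t j * D j ((λ k → a * x k + y k) ◁ z)))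
          ≈⟨ sum-cong-≋ (λ j → *-congˡ {s j} (*-congˡ (lin (alt j)))) ⟩
        (sum λ j → s j * (t j * (a * D j (x ◁ z) + D j (y ◁ z))))
          ≈⟨ sum-cong-≋ (λ j → solve 5 (λ s t a p q →
               s :* (t :* (a :* p :+ q)) := a :* (s :* (t :* p)) :+ s :* (t :* q))
               refl (s j) (t j) a (D j (x ◁ z)) (D j (y ◁ z))) ⟩
        (sum λ j → a * (s j * (t j * D j (x ◁ z))) + s j * (t j * D j (y ◁ z)))
          ≈⟨ ∑-distrib-+ (λ j → a * (s j * (t j * D j (x ◁ z)))) (λ j → s j * (t j * D j (y ◁ z))) ⟩
        (sum λ j → a * (s j * (t j * D j (x ◁ z)))) + (sum λ j → s j * (t j * D j (y ◁ z)))
          ≈⟨ +-congʳ (*-distribˡ-sum a λ j → s j * (t j * D j (x ◁ z))) ⟨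
        a * (sum λ j → s j * (t j * D j (x ◁ z))) + (sum λ j → s j * (t j * D j (y ◁ z))) ∎
        where
        lin : ∀ {D : Form (suc N)} → Alternating D →
              D ((λ k → a * x k + y k) ◁ z) ≈ a * D (x ◁ z) + D (y ◁ z)
        lin (cons _ lin _ _) = lin a x y z

      equal-heads : ∀ N (D : Fin M → Form (suc N)) → (∀ j → Alternating (D j)) →
                    VanishesOnEqualHeads (λ w → sum λ j → s j * (t j * D j w))
      equal-heads zero    D alt = single
      equal-heads (suc N) D alt = double λ x z → sum-zero λ j → begin
        s j * (t j * D j (x ◁ x ◁ z)) ≈⟨ *-congˡ (*-congˡ (vanishes (alt j) x _ zero λ _ → refl)) ⟩
        s j * (t j * 0#)              ≈⟨ *-congˡ (zeroʳ (t j)) ⟩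
        s j * 0#                      ≈⟨ zeroʳ (s j) ⟩
        0#                            ∎

  -- Index `zero` can be deleted either by `j = zero` or by `k = zero` after a successor `j`. These
  -- two families of terms cancel in pairs. In the other terms the factors `- 1#` coming from the
  -- two successors cancel.
  expand-antisymmetric : ∀ n (x : Fin (suc (suc n)) → Carrier)
    (Φ : (Fin n → Fin (suc (suc n))) → Carrier) →
    (sum λ j → sgn j * (x j * sum λ k → sgn k *
      (x (punchIn j k) * Φ (λ m → punchIn j (punchIn k m))))) ≈
    (sum λ (j : Fin (suc n)) → sgn j * (x (suc j) * sum λ (k : Fin n) → sgn k *
      (x (suc (punchIn j k)) * Φ (λ m → punchIn (suc j) (punchIn (suc k) m)))))
  expand-antisymmetric n x Φ = begin
    1# * (x zero * sum λ k → sgn k * (x (suc k) * Φ₀ k)) +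
      (sum λ j → - 1# * sgn j * (x (suc j) * (1# * (x zero * Φ₀ j) + inner j)))
      ≈⟨ +-cong
           (trans (*-identityˡ _) (*-distribˡ-sum (x zero) λ k → sgn k * (x (suc k) * Φ₀ k)))
           (sum-cong-≋ λ j → *-congˡ { - 1# * sgn j} (*-congˡ {x (suc j)} (+-congˡ {1# * (x zero * Φ₀ j)} (inner-neg j)))) ⟩
    (sum λ k → x zero * (sgn k * (x (suc k) * Φ₀ k))) +
      (sum λ j → - 1# * sgn j * (x (suc j) * (1# * (x zero * Φ₀ j) + - inner⁺ j)))
      ≈⟨ ∑-distrib-+ (λ k → x zero * (sgn k * (x (suc k) * Φ₀ k)))
           (λ j → - 1# * sgn j * (x (suc j) * (1# * (x zero * Φ₀ j) + - inner⁺ j))) ⟨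
    (sum λ j → x zero * (sgn j * (x (suc j) * Φ₀ j)) +
               - 1# * sgn j * (x (suc j) * (1# * (x zero * Φ₀ j) + - inner⁺ j)))
      ≈⟨ sum-cong-≋ (λ j → solve 5 (λ a s b p q →
           a :* (s :* (b :* p)) :+ :- :1 :* s :* (b :* (:1 :* (a :* p) :+ :- q))
             := s :* (b :* q)) refl (x zero) (sgn j) (x (suc j)) (Φ₀ j) (inner⁺ j)) ⟩
    (sum λ j → sgn j * (x (suc j) * inner⁺ j)) ∎
    where
    Φ₀ inner inner⁺ : Fin (suc n) → Carrier
    Φ₀ k = Φ (λ m → suc (punchIn k m))
    inner j = sum λ k → - 1# * sgn k * (x (suc (punchIn j k)) *
      Φ (λ m → punchIn (suc j) (punchIn (suc k) m)))
    inner⁺ j = sum λ k → sgn k * (x (suc (punchIn j k)) *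
      Φ (λ m → punchIn (suc j) (punchIn (suc k) m)))

    inner-neg : ∀ j → inner j ≈ - inner⁺ j
    inner-neg j = begin
      inner j
        ≈⟨ sum-cong-≋ (λ k → *-assoc (- 1#) (sgn k) (t k)) ⟩
      (sum λ k → - 1# * (sgn k * t k))
        ≈⟨ *-distribˡ-sum (- 1#) (λ k → sgn k * t k) ⟨
      - 1# * inner⁺ j
        ≈⟨ -1*x≈-x _ ⟩
      - inner⁺ j ∎
      where
      t : Fin n → Carrier
      t k = x (suc (punchIn j k)) * Φ (λ m → punchIn (suc j) (punchIn (suc k) m))

  -- Deleting j and then the k-th remaining index is the same as deleting them
  -- in the other order, and the two orders carry opposite signs.
  antisymmetric-sum : ∀ n (x : Fin (suc (suc n)) → Carrier)
    (Φ : (Fin n → Fin (suc (suc n))) → Carrier) →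
    (∀ {f g} → (∀ m → f m ≡ g m) → Φ f ≈ Φ g) →
    (sum λ j → sgn j * (x j * sum λ k → sgn k *
      (x (punchIn j k) * Φ (λ m → punchIn j (punchIn k m))))) ≈ 0#
  antisymmetric-sum zero    x Φ Φ-cong = trans (expand-antisymmetric 0 x Φ)
    (solve 1 (λ a → :1 :* (a :* :0) :+ :0 := :0) refl (x (suc zero)))
  antisymmetric-sum (suc n) x Φ Φ-cong = trans (expand-antisymmetric (suc n) x Φ) (trans
    -- Deleting two successors leaves `zero` in place, so the deleting maps are `lift 1` of those
    -- one size down and the induction applies to `Φ` after `lift 1`. The maps agree only pointwise,
    -- which is what `Φ-cong` absorbs.
    (sum-cong-≋ λ j → *-congˡ {sgn j} (*-congˡ {x (suc j)} (sum-cong-≋ λ k →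
      *-congˡ {sgn k} (*-congˡ {x (suc (punchIn j k))}
        (Φ-cong {λ m → punchIn (suc j) (punchIn (suc k) m)}
                {lift 1 (λ m → punchIn j (punchIn k m))}
                λ { zero → ≡.refl ; (suc m) → ≡.refl })))))
    (antisymmetric-sum n (λ j → x (suc j)) (λ f → Φ (lift 1 f))
      (λ {f} {g} f≡g → Φ-cong {lift 1 f} {lift 1 g}
        λ { zero → ≡.refl ; (suc m) → ≡.cong suc (f≡g m) })))

  -- The column selection `f` makes the induction possible: a minor uses the same row vectors of
  -- length `K` and only changes `f` to `f` after `punchIn j`.
  det-alternating : ∀ {K} N (f : Fin N → Fin K) →
                    Alternating {K} (λ w → det rawRing (λ r k → w r (f k)))
  det-alternating zero    f = nil λ _ → refl
  det-alternating (suc N) f = cons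
    (λ w≋w' → det-cong λ r k → w≋w' r (f k))
    linear
    (equal-heads N f)
    (λ x → alternating-sum (λ j → det-alternating N (λ k → f (punchIn j k))) sgn (λ j → x (f j)))
    where
    linear : LinearInHead (λ w → det rawRing (λ r k → w r (f k)))
    linear a x y z = begin
      (sum λ j → sgn j * ((a * x (f j) + y (f j)) * d j))
        ≈⟨ sum-cong-≋ (λ j → solve 5 (λ s a p q d →
             s :* ((a :* p :+ q) :* d) := a :* (s :* (p :* d)) :+ s :* (q :* d))
             refl (sgn j) a (x (f j)) (y (f j)) (d j)) ⟩
      (sum λ j → a * (sgn j * (x (f j) * d j)) + sgn j * (y (f j) * d j))
        ≈⟨ ∑-distrib-+ (λ j → a * (sgn j * (x (f j) * d j))) (λ j → sgn j * (y (f j) * d j)) ⟩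
      (sum λ j → a * (sgn j * (x (f j) * d j))) + (sum λ j → sgn j * (y (f j) * d j))
        ≈⟨ +-congʳ (*-distribˡ-sum a λ j → sgn j * (x (f j) * d j)) ⟨
      a * (sum λ j → sgn j * (x (f j) * d j)) + (sum λ j → sgn j * (y (f j) * d j)) ∎
      where
      d : Fin (suc N) → Carrier
      d j = det rawRing (λ r k → z r (f (punchIn j k)))

    equal-heads : ∀ N (f : Fin (suc N) → Fin _) → VanishesOnEqualHeads {N = N} (λ w → det rawRing (λ r k → w r (f k)))
    equal-heads zero    f = single
    equal-heads (suc N) f = double λ x z → antisymmetric-sum N (λ j → x (f j))
      (λ g → det rawRing (λ r k → z r (f (g k))))
      (λ g≡h → det-cong λ r k → reflexive (≡.cong (λ i → z r (f i)) (g≡h k)))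

  infixl 7 _⊛_
  _⊛_ : ∀ {N} → Matrix Carrier N → Matrix Carrier N → Matrix Carrier N
  (A ⊛ B) i k = sum λ j → A i j * B j k

  δ : ∀ {N} → Matrix Carrier N
  δ i j = if ⌊ i ≟ j ⌋ then 1# else 0#

  δ-sym : ∀ {N} (i j : Fin N) → δ i j ≈ δ j i
  δ-sym i j with i ≟ j | j ≟ i
  ... | yes _   | yes _   = refl
  ... | yes i≡j | no  j≢i = contradiction (≡.sym i≡j) j≢i
  ... | no  i≢j | yes j≡i = contradiction (≡.sym j≡i) i≢j
  ... | no  _   | no  _   = refl

  -- The rows of `A ⊛ B` are the combinations of the rows of `B` with coefficients from `A`, so this
  -- is `alternating-det` for the determinant as a form in its rows.
  det-⊛ : ∀ {N} (A B : Matrix Carrier N) → det rawRing (A ⊛ B) ≈ det rawRing A * det rawRing B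
  det-⊛ {N} A B = alternating-det (det-alternating N id) A B

  δ-suc : ∀ {N} (i j : Fin N) → δ (suc i) (suc j) ≈ δ i j
  δ-suc i j with i ≟ j
  ... | yes _ = refl
  ... | no  _ = refl

  sum-δ : ∀ {N} (i : Fin N) (f : Fin N → Carrier) → (sum λ j → δ i j * f j) ≈ f i
  sum-δ zero    f = trans
    (+-cong (*-identityˡ _) (sum-zero λ j → zeroˡ (f (suc j)))) (+-identityʳ _)
  sum-δ (suc i) f = trans
    (+-cong (zeroˡ (f zero))
            (trans (sum-cong-≋ λ j → *-congʳ (δ-suc i j)) (sum-δ i λ j → f (suc j))))
    (+-identityˡ _)

  det-δ : ∀ N → det rawRing (δ {N}) ≈ 1#
  det-δ zero    = refl
  det-δ (suc N) = begin
    1# * (1# * minor zero) + (sum λ j → sgn (suc j) * (0# * minor (suc j)))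
      ≈⟨ +-cong (*-congˡ (*-congˡ (trans (det-cong {N} δ-suc) (det-δ N))))
                (sum-zero {N} λ j → trans (*-congˡ {sgn (suc j)} (zeroˡ (minor (suc j)))) (zeroʳ _)) ⟩
    1# * (1# * 1#) + 0#
      ≈⟨ solve 0 (:1 :* (:1 :* :1) :+ :0 := :1) refl ⟩
    1# ∎
    where
    minor : Fin (suc N) → Carrier
    minor j = det rawRing (λ r k → δ {suc N} (suc r) (punchIn j k))

  -- The determinants of `P` and `P⁻¹` multiply to 1, and so `det P` can be cancelled in a ring that
  -- need not be a field.
  det-conjugate : ∀ {N} {P P⁻¹ A B : Matrix Carrier N} →
                  P⁻¹ ⊛ P ≋ δ → P ⊛ A ≋ B ⊛ P → det rawRing A ≈ det rawRing B
  det-conjugate {N} {P} {P⁻¹} {A} {B} inverse intertwines = begin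
    det rawRing A                    ≈⟨ *-identityˡ _ ⟨
    1# * det rawRing A               ≈⟨ *-congʳ unit ⟨
    p' * p * det rawRing A           ≈⟨ *-assoc p' p _ ⟩
    p' * (p * det rawRing A)         ≈⟨ *-congˡ (det-⊛ P A) ⟨
    p' * det rawRing (P ⊛ A)         ≈⟨ *-congˡ (det-cong intertwines) ⟩
    p' * det rawRing (B ⊛ P)         ≈⟨ *-congˡ (det-⊛ B P) ⟩
    p' * (det rawRing B * p)         ≈⟨ solve 3 (λ q b p → q :* (b :* p) := q :* p :* b) refl p' _ p ⟩
    p' * p * det rawRing B           ≈⟨ *-congʳ unit ⟩
    1# * det rawRing B               ≈⟨ *-identityˡ _ ⟩
    det rawRing B                    ∎
    where
    p p' : Carrier
    p  = det rawRing P
    p' = det rawRing P⁻¹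

    unit : p' * p ≈ 1#
    unit = trans (sym (det-⊛ P⁻¹ P)) (trans (det-cong inverse) (det-δ N))

-- Characteristic polynomials of similar matrices

module PolynomialRing {c ℓ} (R : CommutativeRing c ℓ) where
  open import Data.List.Base using (map)
  open CommutativeRing R hiding (zero)
  open RingProperties ring
  open RingSolver R hiding (Polynomial)
  open Polynomial rawRing public
    renaming (_+ₚ_ to infixl 6 _+ₚ_; _*ₚ_ to infixl 7 _*ₚ_)
  open SetoidReasoning setoid

  infix 4 _≈ₚ_
  _≈ₚ_ : Poly → Poly → Set ℓ
  p ≈ₚ q = ∀ k → coeff p k ≈ coeff q k

  scale : Carrier → Poly → Poly
  scale a = map (a *_)

  coeff-+ : ∀ p q k → coeff (p +ₚ q) k ≈ coeff p k + coeff q k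
  coeff-+ []      q       k       = sym (+-identityˡ _)
  coeff-+ (a ∷ p) []      k       = sym (+-identityʳ _)
  coeff-+ (a ∷ p) (b ∷ q) zero    = refl
  coeff-+ (a ∷ p) (b ∷ q) (suc k) = coeff-+ p q k

  coeff-scale : ∀ a p k → coeff (scale a p) k ≈ a * coeff p k
  coeff-scale a []      k       = sym (zeroʳ a)
  coeff-scale a (b ∷ p) zero    = refl
  coeff-scale a (b ∷ p) (suc k) = coeff-scale a p k

  coeff-neg : ∀ p k → coeff (map (-_) p) k ≈ - coeff p k
  coeff-neg []      k       = sym -0#≈0#
  coeff-neg (a ∷ p) zero    = refl
  coeff-neg (a ∷ p) (suc k) = coeff-neg p k

  ∷-cong : ∀ {a b p q} → a ≈ b → p ≈ₚ q → (a ∷ p) ≈ₚ (b ∷ q)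
  ∷-cong a≈b p≈q zero    = a≈b
  ∷-cong a≈b p≈q (suc k) = p≈q k

  coeff-* : ∀ a p q k →
            coeff ((a ∷ p) *ₚ q) k ≈ a * coeff q k + coeff (0# ∷ p *ₚ q) k
  coeff-* a p q k = trans (coeff-+ (scale a q) _ k) (+-congʳ (coeff-scale a q k))

  +ₚ-cong : ∀ {p p' q q'} → p ≈ₚ p' → q ≈ₚ q' → (p +ₚ q) ≈ₚ (p' +ₚ q')
  +ₚ-cong {p} {p'} {q} {q'} p≈p' q≈q' k =
    trans (coeff-+ p q k) (trans (+-cong (p≈p' k) (q≈q' k)) (sym (coeff-+ p' q' k)))

  -- A polynomial equal to `[]` may still be a nonempty list of zeros; congruence of the product
  -- meets this case when the lists have different lengths.
  *ₚ-zeroˡ : ∀ p q → p ≈ₚ [] → (p *ₚ q) ≈ₚ []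
  *ₚ-zeroˡ []      q p≈0 k = refl
  *ₚ-zeroˡ (a ∷ p) q p≈0 k = begin
    coeff ((a ∷ p) *ₚ q) k                ≈⟨ coeff-* a p q k ⟩
    a * coeff q k + coeff (0# ∷ p *ₚ q) k ≈⟨ +-cong (*-congʳ (p≈0 0)) (shifted k) ⟩
    0# * coeff q k + 0#                   ≈⟨ trans (+-identityʳ _) (zeroˡ _) ⟩
    0#                                    ∎
    where
    shifted : (0# ∷ p *ₚ q) ≈ₚ []
    shifted zero    = refl
    shifted (suc k) = *ₚ-zeroˡ p q (λ i → p≈0 (suc i)) k

  *ₚ-congʳ : ∀ p p' q → p ≈ₚ p' → (p *ₚ q) ≈ₚ (p' *ₚ q)
  *ₚ-congʳ []      p'       q p≈p' k = sym (*ₚ-zeroˡ p' q (λ i → sym (p≈p' i)) k)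
  *ₚ-congʳ (a ∷ p) []       q p≈p' k = *ₚ-zeroˡ (a ∷ p) q p≈p' k
  *ₚ-congʳ (a ∷ p) (b ∷ p') q p≈p' k = begin
    coeff ((a ∷ p) *ₚ q) k                 ≈⟨ coeff-* a p q k ⟩
    a * coeff q k + coeff (0# ∷ p *ₚ q) k
      ≈⟨ +-cong (*-congʳ (p≈p' 0)) (∷-cong refl (*ₚ-congʳ p p' q (λ i → p≈p' (suc i))) k) ⟩
    b * coeff q k + coeff (0# ∷ p' *ₚ q) k ≈⟨ coeff-* b p' q k ⟨
    coeff ((b ∷ p') *ₚ q) k                ∎

  *ₚ-congˡ : ∀ p {q q'} → q ≈ₚ q' → (p *ₚ q) ≈ₚ (p *ₚ q')
  *ₚ-congˡ []      q≈q' k = refl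
  *ₚ-congˡ (a ∷ p) {q} {q'} q≈q' k = begin
    coeff ((a ∷ p) *ₚ q) k                 ≈⟨ coeff-* a p q k ⟩
    a * coeff q k + coeff (0# ∷ p *ₚ q) k
      ≈⟨ +-cong (*-congˡ (q≈q' k)) (∷-cong refl (*ₚ-congˡ p q≈q') k) ⟩
    a * coeff q' k + coeff (0# ∷ p *ₚ q') k ≈⟨ coeff-* a p q' k ⟨
    coeff ((a ∷ p) *ₚ q') k                ∎

  shift-+ : ∀ p q k → coeff (0# ∷ (p +ₚ q)) k ≈ coeff (0# ∷ p) k + coeff (0# ∷ q) k
  shift-+ p q zero    = sym (+-identityˡ 0#)
  shift-+ p q (suc k) = coeff-+ p q k

  *ₚ-distribʳ-+ₚ : ∀ r p q → ((p +ₚ q) *ₚ r) ≈ₚ (p *ₚ r +ₚ q *ₚ r)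
  *ₚ-distribʳ-+ₚ r []      q       k = refl
  *ₚ-distribʳ-+ₚ r (a ∷ p) []      k =
    sym (trans (coeff-+ ((a ∷ p) *ₚ r) [] k) (+-identityʳ _))
  *ₚ-distribʳ-+ₚ r (a ∷ p) (b ∷ q) k = begin
    coeff ((a + b ∷ (p +ₚ q)) *ₚ r) k
      ≈⟨ coeff-* (a + b) (p +ₚ q) r k ⟩
    (a + b) * coeff r k + coeff (0# ∷ (p +ₚ q) *ₚ r) k
      ≈⟨ +-congˡ (trans (∷-cong refl (*ₚ-distribʳ-+ₚ r p q) k) (shift-+ (p *ₚ r) (q *ₚ r) k)) ⟩
    (a + b) * coeff r k + (coeff (0# ∷ p *ₚ r) k + coeff (0# ∷ q *ₚ r) k)
      ≈⟨ solve 5 (λ a b r p q → (a :+ b) :* r :+ (p :+ q) := (a :* r :+ p) :+ (b :* r :+ q))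
           refl a b (coeff r k) _ _ ⟩
    (a * coeff r k + coeff (0# ∷ p *ₚ r) k) + (b * coeff r k + coeff (0# ∷ q *ₚ r) k)
      ≈⟨ +-cong (coeff-* a p r k) (coeff-* b q r k) ⟨
    coeff ((a ∷ p) *ₚ r) k + coeff ((b ∷ q) *ₚ r) k
      ≈⟨ coeff-+ ((a ∷ p) *ₚ r) _ k ⟨
    coeff ((a ∷ p) *ₚ r +ₚ (b ∷ q) *ₚ r) k ∎

  *ₚ-zeroʳ : ∀ p → (p *ₚ []) ≈ₚ []
  *ₚ-zeroʳ []      k       = refl
  *ₚ-zeroʳ (a ∷ p) zero    = refl
  *ₚ-zeroʳ (a ∷ p) (suc k) = *ₚ-zeroʳ p k

  -- The product recurses on its left factor. This is the mirror image of `coeff-*`, and the two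
  -- recurrences together give commutativity by induction on one list.
  coeff-*ʳ : ∀ p b q k →
             coeff (p *ₚ (b ∷ q)) k ≈ b * coeff p k + coeff (0# ∷ p *ₚ q) k
  coeff-*ʳ []      b q zero    = solve 1 (λ b → :0 := b :* :0 :+ :0) refl b
  coeff-*ʳ []      b q (suc k) = solve 1 (λ b → :0 := b :* :0 :+ :0) refl b
  coeff-*ʳ (a ∷ p) b q zero    = +-congʳ (*-comm a b)
  coeff-*ʳ (a ∷ p) b q (suc k) = begin
    coeff ((a ∷ p) *ₚ (b ∷ q)) (suc k)
      ≈⟨ coeff-* a p (b ∷ q) (suc k) ⟩
    a * coeff q k + coeff (p *ₚ (b ∷ q)) k
      ≈⟨ +-congˡ (coeff-*ʳ p b q k) ⟩
    a * coeff q k + (b * coeff p k + coeff (0# ∷ p *ₚ q) k)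
      ≈⟨ solve 3 (λ x y z → x :+ (y :+ z) := y :+ (x :+ z)) refl _ _ _ ⟩
    b * coeff p k + (a * coeff q k + coeff (0# ∷ p *ₚ q) k)
      ≈⟨ +-congˡ (coeff-* a p q k) ⟨
    b * coeff p k + coeff ((a ∷ p) *ₚ q) k ∎

  *ₚ-comm : ∀ p q → (p *ₚ q) ≈ₚ (q *ₚ p)
  *ₚ-comm []      q k = sym (*ₚ-zeroʳ q k)
  *ₚ-comm (a ∷ p) q k = begin
    coeff ((a ∷ p) *ₚ q) k                ≈⟨ coeff-* a p q k ⟩
    a * coeff q k + coeff (0# ∷ p *ₚ q) k ≈⟨ +-congˡ (∷-cong refl (*ₚ-comm p q) k) ⟩
    a * coeff q k + coeff (0# ∷ q *ₚ p) k ≈⟨ coeff-*ʳ q a p k ⟨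
    coeff (q *ₚ (a ∷ p)) k                ∎

  scale-*ₚ : ∀ a p q → (scale a p *ₚ q) ≈ₚ scale a (p *ₚ q)
  scale-*ₚ a []      q k = refl
  scale-*ₚ a (b ∷ p) q k = begin
    coeff ((a * b ∷ scale a p) *ₚ q) k
      ≈⟨ coeff-* (a * b) (scale a p) q k ⟩
    a * b * coeff q k + coeff (0# ∷ scale a p *ₚ q) k
      ≈⟨ +-congˡ (trans (∷-cong (sym (zeroʳ a)) (scale-*ₚ a p q) k)
                        (coeff-scale a (0# ∷ p *ₚ q) k)) ⟩
    a * b * coeff q k + a * coeff (0# ∷ p *ₚ q) k
      ≈⟨ solve 4 (λ a b x y → a :* b :* x :+ a :* y := a :* (b :* x :+ y)) refl a b _ _ ⟩
    a * (b * coeff q k + coeff (0# ∷ p *ₚ q) k)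
      ≈⟨ *-congˡ (coeff-* b p q k) ⟨
    a * coeff ((b ∷ p) *ₚ q) k
      ≈⟨ coeff-scale a ((b ∷ p) *ₚ q) k ⟨
    coeff (scale a ((b ∷ p) *ₚ q)) k ∎

  *ₚ-assoc : ∀ p q r → (p *ₚ q *ₚ r) ≈ₚ (p *ₚ (q *ₚ r))
  *ₚ-assoc []      q r k = refl
  *ₚ-assoc (a ∷ p) q r k = begin
    coeff ((a ∷ p) *ₚ q *ₚ r) k
      ≈⟨ *ₚ-distribʳ-+ₚ r (scale a q) (0# ∷ p *ₚ q) k ⟩
    coeff (scale a q *ₚ r +ₚ (0# ∷ p *ₚ q) *ₚ r) k
      ≈⟨ coeff-+ (scale a q *ₚ r) _ k ⟩
    coeff (scale a q *ₚ r) k + coeff ((0# ∷ p *ₚ q) *ₚ r) k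
      ≈⟨ +-cong (trans (scale-*ₚ a q r k) (coeff-scale a (q *ₚ r) k))
                (coeff-* 0# (p *ₚ q) r k) ⟩
    a * coeff (q *ₚ r) k + (0# * coeff r k + coeff (0# ∷ p *ₚ q *ₚ r) k)
      ≈⟨ +-congˡ (trans (+-congʳ (zeroˡ _)) (+-identityˡ _)) ⟩
    a * coeff (q *ₚ r) k + coeff (0# ∷ p *ₚ q *ₚ r) k
      ≈⟨ +-congˡ (∷-cong refl (*ₚ-assoc p q r) k) ⟩
    a * coeff (q *ₚ r) k + coeff (0# ∷ p *ₚ (q *ₚ r)) k
      ≈⟨ coeff-* a p (q *ₚ r) k ⟨
    coeff ((a ∷ p) *ₚ (q *ₚ r)) k ∎

  *ₚ-identityˡ : ∀ p → ((1# ∷ []) *ₚ p) ≈ₚ p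
  *ₚ-identityˡ p k = trans (coeff-* 1# [] p k)
    (trans (+-cong (*-identityˡ _) (shifted k)) (+-identityʳ _))
    where
    shifted : (0# ∷ []) ≈ₚ []
    shifted zero    = refl
    shifted (suc k) = refl

  polynomialRing : CommutativeRing c ℓ
  polynomialRing = record
    { Carrier = Poly
    ; _≈_ = _≈ₚ_
    ; _+_ = _+ₚ_
    ; _*_ = _*ₚ_
    ; -_  = map (-_)
    ; 0#  = []
    ; 1#  = 1# ∷ []
    ; isCommutativeRing = record
      { isRing = record
        { +-isAbelianGroup = record
          { isGroup = record
            { isMonoid = record
              { isSemigroup = record
                { isMagma = record
                  { isEquivalence = record
                    { refl  = λ k → refl
                    ; sym   = λ p≈q k → sym (p≈q k)
                    ; trans = λ p≈q q≈r k → trans (p≈q k) (q≈r k)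
                    }
                  ; ∙-cong = λ {p} {p'} {q} {q'} → +ₚ-cong {p} {p'} {q} {q'}
                  }
                ; assoc = λ p q r k → begin
                    coeff (p +ₚ q +ₚ r) k
                      ≈⟨ trans (coeff-+ (p +ₚ q) r k) (+-congʳ (coeff-+ p q k)) ⟩
                    coeff p k + coeff q k + coeff r k
                      ≈⟨ +-assoc _ _ _ ⟩
                    coeff p k + (coeff q k + coeff r k)
                      ≈⟨ trans (coeff-+ p (q +ₚ r) k) (+-congˡ (coeff-+ q r k)) ⟨
                    coeff (p +ₚ (q +ₚ r)) k ∎
                }
              ; identity = (λ p k → refl)
                         , (λ p k → trans (coeff-+ p [] k) (+-identityʳ _))
              }
            ; inverse =
                (λ p k → trans (coeff-+ (map (-_) p) p k)
                          (trans (+-congʳ (coeff-neg p k)) (-‿inverseˡ _)))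
              , (λ p k → trans (coeff-+ p (map (-_) p) k)
                          (trans (+-congˡ (coeff-neg p k)) (-‿inverseʳ _)))
            ; ⁻¹-cong = λ {p} {q} p≈q k →
                trans (coeff-neg p k) (trans (-‿cong (p≈q k)) (sym (coeff-neg q k)))
            }
          ; comm = λ p q k →
              trans (coeff-+ p q k) (trans (+-comm _ _) (sym (coeff-+ q p k)))
          }
        ; *-cong = λ {p} {p'} {q} {q'} p≈p' q≈q' k →
            trans (*ₚ-congʳ p p' q p≈p' k) (*ₚ-congˡ p' q≈q' k)
        ; *-assoc = *ₚ-assoc
        ; *-identity = *ₚ-identityˡ
                     , (λ p k → trans (*ₚ-comm p (1# ∷ []) k) (*ₚ-identityˡ p k))
        ; distrib =
            (λ p q r k → begin
              coeff (p *ₚ (q +ₚ r)) k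
                ≈⟨ *ₚ-comm p (q +ₚ r) k ⟩
              coeff ((q +ₚ r) *ₚ p) k
                ≈⟨ *ₚ-distribʳ-+ₚ p q r k ⟩
              coeff (q *ₚ p +ₚ r *ₚ p) k
                ≈⟨ +ₚ-cong {q *ₚ p} {p *ₚ q} (*ₚ-comm q p) (*ₚ-comm r p) k ⟩
              coeff (p *ₚ q +ₚ p *ₚ r) k ∎)
          , *ₚ-distribʳ-+ₚ
        }
      ; *-comm = *ₚ-comm
      }
    }

-- For the characteristic polynomial, φ embeds the constants into the polynomials and X is
-- the indeterminate.
module ConjugateMatrices {c₁ ℓ₁ c₂ ℓ₂} (R : CommutativeRing c₁ ℓ₁) (S : CommutativeRing c₂ ℓ₂)
  {φ : CommutativeRing.Carrier R → CommutativeRing.Carrier S}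
  (φ-homomorphism : IsSemiringHomomorphism
    (RawRing.rawSemiring (CommutativeRing.rawRing R)) (RawRing.rawSemiring (CommutativeRing.rawRing S)) φ) where

  open CommutativeRing S hiding (zero)
  open Determinants S
  open SemiringSum semiring
  open SetoidReasoning setoid
  open IsSemiringHomomorphism φ-homomorphism
  private
    module R  = CommutativeRing R
    module RD = Determinants R
    module RS = SemiringSum R.semiring
    module RP = RingProperties R.ring
    open RD using () renaming (_⊛_ to _⊛ᴿ_; _≋_ to _≋ᴿ_)

  φ-sum : ∀ {n} (f : Fin n → R.Carrier) → φ (RS.sum f) ≈ sum λ i → φ (f i)
  φ-sum {zero}  f = 0#-homo
  φ-sum {suc n} f = trans (+-homo (f zero) _) (+-congˡ (φ-sum λ i → f (suc i)))

  φ-⊛ : ∀ {N} (A B : Matrix R.Carrier N) i k →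
        ((λ x y → φ (A x y)) ⊛ (λ x y → φ (B x y))) i k ≈ φ ((A ⊛ᴿ B) i k)
  φ-⊛ A B i k = sym (trans (φ-sum λ j → A i j R.* B j k)
    (sum-cong-≋ λ j → *-homo (A i j) (B j k)))

  φ-δ : ∀ {N} (i j : Fin N) → φ (RD.δ i j) ≈ δ i j
  φ-δ i j with i ≟ j
  ... | yes _ = 1#-homo
  ... | no  _ = 0#-homo

  neg-⊛ˡ : ∀ {N} (A B : Matrix R.Carrier N) i k →
           ((λ x y → R.- A x y) ⊛ᴿ B) i k R.≈ R.- (A ⊛ᴿ B) i k
  neg-⊛ˡ A B i k = R.trans
    (RS.sum-cong-≋ λ j → R.trans (R.sym (RP.-‿distribˡ-* (A i j) (B j k))) (R.sym (RP.-1*x≈-x _)))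
    (R.trans (R.sym (RS.*-distribˡ-sum (R.- R.1#) λ j → A i j R.* B j k)) (RP.-1*x≈-x _))

  neg-⊛ʳ : ∀ {N} (A B : Matrix R.Carrier N) i k →
           (A ⊛ᴿ (λ x y → R.- B x y)) i k R.≈ R.- (A ⊛ᴿ B) i k
  neg-⊛ʳ A B i k = R.trans
    (RS.sum-cong-≋ λ j →
      R.trans (R.sym (RP.-‿distribʳ-* (A i j) (B j k))) (RP.-‿distribˡ-* (A i j) (B j k)))
    (neg-⊛ˡ A B i k)

  module _ (X : Carrier) where

    -- The negation stands inside `φ` since a semiring homomorphism says nothing about negatives,
    -- and since the entries of `charPoly` have the form `constant (- a)`.
    xI-φ : ∀ {N} → Matrix R.Carrier N → Matrix Carrier N
    xI-φ A x y = δ x y * X + φ (R.- A x y)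

    module _ {N} {P P⁻¹ A B : Matrix R.Carrier N}
             (inverse : P⁻¹ ⊛ᴿ P ≋ᴿ RD.δ) (intertwines : P ⊛ᴿ A ≋ᴿ B ⊛ᴿ P) where
      private
        φP : Matrix Carrier N
        φP x y = φ (P x y)

      left : ∀ i k → (φP ⊛ xI-φ A) i k ≈ φP i k * X + φ (R.- (P ⊛ᴿ A) i k)
      left i k = begin
        (φP ⊛ xI-φ A) i k
          ≈⟨ sum-cong-≋ (λ j → trans (distribˡ (φP i j) (δ j k * X) (φ (R.- A j k)))
               (+-congʳ (trans (*-congˡ (*-congʳ (δ-sym j k))) (rearrange (φP i j) (δ k j))))) ⟩
        sum (λ j → δ k j * (φP i j * X) + φP i j * φ (R.- A j k))
          ≈⟨ ∑-distrib-+ (λ j → δ k j * (φP i j * X)) (λ j → φP i j * φ (R.- A j k)) ⟩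
        sum (λ j → δ k j * (φP i j * X)) + (φP ⊛ (λ x y → φ (R.- A x y))) i k
          ≈⟨ +-cong (sum-δ k (λ j → φP i j * X))
                    (trans (φ-⊛ P (λ x y → R.- A x y) i k) (⟦⟧-cong (neg-⊛ʳ P A i k))) ⟩
        φP i k * X + φ (R.- (P ⊛ᴿ A) i k) ∎
        where
        rearrange : ∀ p d → p * (d * X) ≈ d * (p * X)
        rearrange p d = trans (sym (*-assoc p d X))
          (trans (*-congʳ (*-comm p d)) (*-assoc d p X))

      right : ∀ i k → (xI-φ B ⊛ φP) i k ≈ φP i k * X + φ (R.- (B ⊛ᴿ P) i k)
      right i k = begin
        (xI-φ B ⊛ φP) i k
          ≈⟨ sum-cong-≋ (λ j → trans (distribʳ (φP j k) (δ i j * X) (φ (R.- B i j)))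
               (+-congʳ (trans (*-assoc (δ i j) X (φP j k)) (*-congˡ (*-comm X (φP j k)))))) ⟩
        sum (λ j → δ i j * (φP j k * X) + φ (R.- B i j) * φP j k)
          ≈⟨ ∑-distrib-+ (λ j → δ i j * (φP j k * X)) (λ j → φ (R.- B i j) * φP j k) ⟩
        sum (λ j → δ i j * (φP j k * X)) + ((λ x y → φ (R.- B x y)) ⊛ φP) i k
          ≈⟨ +-cong (sum-δ i (λ j → φP j k * X))
                    (trans (φ-⊛ (λ x y → R.- B x y) P i k) (⟦⟧-cong (neg-⊛ˡ B P i k))) ⟩
        φP i k * X + φ (R.- (B ⊛ᴿ P) i k) ∎

      -- The scalar matrix of `X` commutes with `φP`, so the intertwining of `A` and `B` by `P`
      -- carries over to `X I - A` and `X I - B`.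
      det-xI-φ : det rawRing (xI-φ A) ≈ det rawRing (xI-φ B)
      det-xI-φ = det-conjugate
        {P = φP} {P⁻¹ = λ x y → φ (P⁻¹ x y)} {A = xI-φ A} {B = xI-φ B}
        (λ i k → trans (φ-⊛ P⁻¹ P i k) (trans (⟦⟧-cong (inverse i k)) (φ-δ i k)))
        (λ i k → trans (left i k) (trans
          (+-congˡ (⟦⟧-cong (R.-‿cong (intertwines i k)))) (sym (right i k))))

module CharacteristicPolynomial {c ℓ} (R : CommutativeRing c ℓ) where
  open CommutativeRing R hiding (zero)
  open Determinants R
  open PolynomialRing R
  private
    module P  = CommutativeRing polynomialRing
    module PD = Determinants polynomialRing

  constant : Carrier → Poly
  constant a = a ∷ []

  X : Poly
  X = 0# ∷ 1# ∷ []

  constant-homomorphism : IsSemiringHomomorphism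
    (RawRing.rawSemiring rawRing) (RawRing.rawSemiring P.rawRing) constant
  constant-homomorphism = record
    { isNearSemiringHomomorphism = record
      { +-isMonoidHomomorphism = record
        { isMagmaHomomorphism = record
          { isRelHomomorphism = record { cong = λ a≈b → ∷-cong a≈b λ k → refl }
          ; homo = λ a b k → refl
          }
        ; ε-homo = λ { zero → refl ; (suc k) → refl }
        }
      ; *-homo = λ { a b zero → sym (+-identityʳ (a * b)) ; a b (suc k) → refl }
      }
    ; 1#-homo = λ k → refl
    }

  open ConjugateMatrices R polynomialRing constant-homomorphism

  xI-entry : ∀ {N} (M : Matrix Carrier N) x y →
    (if ⌊ x ≟ y ⌋ then X- (M x y) else (- M x y ∷ [])) ≈ₚ xI-φ X M x y
  xI-entry M x y with x ≟ y
  ... | no  _ = λ k → refl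
  ... | yes _ = P.trans {X- (M x y)} {X +ₚ constant (- M x y)} {(1# ∷ []) *ₚ X +ₚ constant (- M x y)}
    (∷-cong (sym (+-identityˡ _)) λ k → refl)
    (P.+-congʳ {constant (- M x y)} {X} {(1# ∷ []) *ₚ X} (P.sym {(1# ∷ []) *ₚ X} {X} (P.*-identityˡ X)))

  charPoly-xI : ∀ {N} (M : Matrix Carrier N) → charPoly M ≈ₚ det P.rawRing (xI-φ X M)
  charPoly-xI M = PD.det-cong (xI-entry M)

  charPoly-conjugate : ∀ {N} {P P⁻¹ A B : Matrix Carrier N} →
    P⁻¹ ⊛ P ≋ δ → P ⊛ A ≋ B ⊛ P → charPoly A ≈ₚ charPoly B
  charPoly-conjugate {P = P} {P⁻¹} {A} {B} inverse intertwines k = trans (charPoly-xI A k)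
    (trans (det-xI-φ X {P = P} {P⁻¹} {A} {B} inverse intertwines k) (sym (charPoly-xI B k)))

  charPoly-cong : ∀ {N} {A B : Matrix Carrier N} → A ≋ B → charPoly A ≈ₚ charPoly B
  charPoly-cong {A = A} {B} A≋B = PD.det-cong entries
    where
    entries : ∀ x y → (if ⌊ x ≟ y ⌋ then X- (A x y) else (- A x y ∷ [])) ≈ₚ
                      (if ⌊ x ≟ y ⌋ then X- (B x y) else (- B x y ∷ []))
    entries x y with x ≟ y
    ... | yes _ = ∷-cong (-‿cong (A≋B x y)) λ k → refl
    ... | no  _ = ∷-cong (-‿cong (A≋B x y)) λ k → refl

-- Laplacian matrices

entry : ∀ {c ℓ} (R : RawRing c ℓ) → Maybe Sign → RawRing.Carrier R
entry R nothing       = RawRing.0# R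
entry R (just Sign.+) = RawRing.1# R
entry R (just Sign.-) = RawRing.-_ R (RawRing.1# R)

flipIf : Bool → Maybe Sign → Maybe Sign
flipIf b e = if b then Maybe.map Sign.opposite e else e

flipIf-nothing : ∀ b → flipIf b nothing ≡ nothing
flipIf-nothing true  = ≡.refl
flipIf-nothing false = ≡.refl

-- Switching at the single vertex `z`: the `xor` selects the pairs with exactly one member `z`. On
-- Laplacians it is conjugation by the diagonal matrix with `- 1#` at `z` and `1#` elsewhere.
switch : ∀ {N} → Fin N → SignedGraph N → SignedGraph N
switch z Γ = record
  { edge        = λ x y → flipIf (⌊ x ≟ z ⌋ xor ⌊ y ≟ z ⌋) (edge Γ x y)
  ; edge-sym    = λ x y → ≡.cong₂ flipIf (xor-comm ⌊ x ≟ z ⌋ ⌊ y ≟ z ⌋) (edge-sym Γ x y)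
  ; edge-irrefl = λ x → ≡.trans
      (≡.cong (flipIf (⌊ x ≟ z ⌋ xor ⌊ x ≟ z ⌋)) (edge-irrefl Γ x))
      (flipIf-nothing (⌊ x ≟ z ⌋ xor ⌊ x ≟ z ⌋))
  }

module LaplacianMatrices {c ℓ} (R : CommutativeRing c ℓ) where
  open CommutativeRing R hiding (zero)
  open RingProperties ring
  open SemiringDefs (RawRing.rawSemiring rawRing) using () renaming (_×_ to _·_)
  open SemiringSum semiring
  open Determinants R
  open RingSolver R
  open SetoidReasoning setoid

  L : ∀ {N} → SignedGraph N → Matrix Carrier N
  L = laplacian rawRing

  adjacent : Maybe Sign → Carrier
  adjacent e = if is-just e then 1# else 0#

  adjacency-entry : ∀ {N} (Γ : SignedGraph N) x y →
                    adjacency rawRing Γ x y ≡ entry rawRing (edge Γ x y)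
  adjacency-entry Γ x y with edge Γ x y
  ... | nothing     = ≡.refl
  ... | just Sign.+ = ≡.refl
  ... | just Sign.- = ≡.refl

  degree-sum : ∀ {N} (Γ : SignedGraph N) x → degree Γ x · 1# ≈ sum λ y → adjacent (edge Γ x y)
  degree-sum Γ x = count λ y → is-just (edge Γ x y)
    where
    count : ∀ {N} (f : Fin N → Bool) →
      Vector.foldr ℕ._+_ 0 (λ y → if f y then 1 else 0) · 1# ≈ sum λ y → if f y then 1# else 0#
    count {zero}  f = refl
    count {suc N} f with f zero
    ... | true  = +-congˡ (count λ y → f (suc y))
    ... | false = trans (count λ y → f (suc y)) (sym (+-identityˡ _))

  laplacian-entry : ∀ {N} (Γ : SignedGraph N) x y →
    L Γ x y ≈ δ x y * (sum λ z → adjacent (edge Γ x z)) - entry rawRing (edge Γ x y)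
  laplacian-entry Γ x y = +-cong diagonal (-‿cong (reflexive (adjacency-entry Γ x y)))
    where
    diagonal : degreeMatrix rawRing Γ x y ≈ δ x y * (sum λ z → adjacent (edge Γ x z))
    diagonal with x ≟ y
    ... | yes _ = trans (degree-sum Γ x) (sym (*-identityˡ _))
    ... | no  _ = sym (zeroˡ _)

  laplacian-cong : ∀ {N} {Γ Δ : SignedGraph N} → (∀ x y → edge Γ x y ≡ edge Δ x y) →
                   L Γ ≋ L Δ
  laplacian-cong {Γ = Γ} {Δ} Γ≗Δ x y = begin
    L Γ x y
      ≈⟨ laplacian-entry Γ x y ⟩
    δ x y * (sum λ z → adjacent (edge Γ x z)) - entry rawRing (edge Γ x y)
      ≈⟨ +-cong (*-congˡ (sum-cong-≋ λ z → reflexive (≡.cong adjacent (Γ≗Δ x z))))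
                (-‿cong (reflexive (≡.cong (entry rawRing) (Γ≗Δ x y)))) ⟩
    δ x y * (sum λ z → adjacent (edge Δ x z)) - entry rawRing (edge Δ x y)
      ≈⟨ laplacian-entry Δ x y ⟨
    L Δ x y ∎

  signValue : Sign → Carrier
  signValue s = entry rawRing (just s)

  signValue² : ∀ s → signValue s * signValue s ≈ 1#
  signValue² Sign.+ = *-identityˡ 1#
  signValue² Sign.- = solve 0 (:- :1 :* :- :1 := :1) refl

  -- Both sides indicate `x = y = z`. This turns the diagonal degree terms of an edge into products
  -- of an indicator of the row and one of the column.
  δ-transport : ∀ {N} (x y z : Fin N) → δ x y * δ x z ≈ δ x z * δ y z
  δ-transport x y z with x ≟ y
  δ-transport x y z | no x≢y with x ≟ z | y ≟ z
  ... | yes x≡z | yes y≡z = contradiction (≡.trans x≡z (≡.sym y≡z)) x≢y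
  ... | yes _   | no _    = *-comm 0# 1#
  ... | no _    | yes _   = trans (zeroˡ 0#) (sym (zeroˡ 1#))
  ... | no _    | no _    = refl
  δ-transport x .x z | yes ≡.refl with x ≟ z
  ... | yes _ = refl
  ... | no  _ = trans (zeroʳ 1#) (sym (zeroˡ 0#))

  module _ {N} (Γ : SignedGraph N) {x y : Fin N} (x≢y : x ≢ y) (s : Sign)
           (new : edge Γ x y ≡ nothing) where

    private
      Γ⁺ : SignedGraph N
      Γ⁺ = addEdge Γ x y x≢y s

      incidence : Fin N → Carrier
      incidence a = δ a x - signValue s * δ a y

    -- A general `F` covers both the unsigned entries that make up degrees and the signed adjacency
    -- entries. The hypothesis `new` is essential, as `addEdge` on an existing edge would replace
    -- its value instead of adding to it.
    addEdge-entry : (F : Maybe Sign → Carrier) → F nothing ≈ 0# → ∀ a b →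
      F (edge Γ⁺ a b) ≈ F (edge Γ a b) + F (just s) * (δ a x * δ b y + δ a y * δ b x)
    addEdge-entry F F0 a b with a ≟ x | b ≟ y | a ≟ y | b ≟ x
    ... | yes a≡x | _       | yes a≡y | _       = contradiction (≡.trans (≡.sym a≡x) a≡y) x≢y
    ... | _       | yes b≡y | _       | yes b≡x = contradiction (≡.trans (≡.sym b≡x) b≡y) x≢y
    ... | yes ≡.refl | yes ≡.refl | no _ | no _ rewrite new = trans
      (solve 1 (λ f → f := :0 :+ f :* (:1 :* :1 :+ :0 :* :0)) refl (F (just s)))
      (+-congʳ (sym F0))
    ... | no _ | no _ | yes ≡.refl | yes ≡.refl rewrite ≡.trans (edge-sym Γ a b) new = trans
      (solve 1 (λ f → f := :0 :+ f :* (:0 :* :0 :+ :1 :* :1)) refl (F (just s)))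
      (+-congʳ (sym F0))
    ... | yes _   | no _    | no _    | yes _   =
      solve 2 (λ e f → e := e :+ f :* (:1 :* :0 :+ :0 :* :1)) refl _ _
    ... | yes _   | no _    | no _    | no _    =
      solve 2 (λ e f → e := e :+ f :* (:1 :* :0 :+ :0 :* :0)) refl _ _
    ... | no _    | yes _   | yes _   | no _    =
      solve 2 (λ e f → e := e :+ f :* (:0 :* :1 :+ :1 :* :0)) refl _ _
    ... | no _    | yes _   | no _    | no _    =
      solve 2 (λ e f → e := e :+ f :* (:0 :* :1 :+ :0 :* :0)) refl _ _
    ... | no _    | no _    | yes _   | no _    =
      solve 2 (λ e f → e := e :+ f :* (:0 :* :0 :+ :1 :* :0)) refl _ _
    ... | no _    | no _    | no _    | yes _   =
      solve 2 (λ e f → e := e :+ f :* (:0 :* :0 :+ :0 :* :1)) refl _ _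
    ... | no _    | no _    | no _    | no _    =
      solve 2 (λ e f → e := e :+ f :* (:0 :* :0 :+ :0 :* :0)) refl _ _

    degree-addEdge : ∀ a → (sum λ b → adjacent (edge Γ⁺ a b)) ≈
                           (sum λ b → adjacent (edge Γ a b)) + (δ a x + δ a y)
    degree-addEdge a = begin
      (sum λ b → adjacent (edge Γ⁺ a b))
        ≈⟨ sum-cong-≋ (λ b → addEdge-entry adjacent refl a b) ⟩
      (sum λ b → adjacent (edge Γ a b) + 1# * (δ a x * δ b y + δ a y * δ b x))
        ≈⟨ sum-cong-≋ (λ b → +-congˡ (trans (*-identityˡ _) (+-cong
             (trans (*-comm _ _) (*-congʳ (δ-sym b y)))
             (trans (*-comm _ _) (*-congʳ (δ-sym b x)))))) ⟩
      (sum λ b → adjacent (edge Γ a b) + (δ y b * δ a x + δ x b * δ a y))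
        ≈⟨ ∑-distrib-+ (λ b → adjacent (edge Γ a b)) (λ b → δ y b * δ a x + δ x b * δ a y) ⟩
      (sum λ b → adjacent (edge Γ a b)) + (sum λ b → δ y b * δ a x + δ x b * δ a y)
        ≈⟨ +-congˡ (trans (∑-distrib-+ (λ b → δ y b * δ a x) (λ b → δ x b * δ a y))
             (+-cong (sum-δ y λ _ → δ a x) (sum-δ x λ _ → δ a y))) ⟩
      (sum λ b → adjacent (edge Γ a b)) + (δ a x + δ a y) ∎

    -- The edge contributes the square of the signed incidence vector; since the sign squares to 1,
    -- the diagonal part of that square is the increase of both degrees.
    laplacian-addEdge : ∀ a b → L Γ⁺ a b ≈ L Γ a b + incidence a * incidence b
    laplacian-addEdge a b = begin
      L Γ⁺ a b
        ≈⟨ laplacian-entry Γ⁺ a b ⟩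
      δ a b * (sum λ z → adjacent (edge Γ⁺ a z)) - entry rawRing (edge Γ⁺ a b)
        ≈⟨ +-cong (*-congˡ (degree-addEdge a)) (-‿cong (addEdge-entry (entry rawRing) refl a b)) ⟩
      δ a b * (d + (δ a x + δ a y)) - (e + σ * (δ a x * δ b y + δ a y * δ b x))
        ≈⟨ solve 8 (λ ab d ax ay bx by e σ →
             ab :* (d :+ (ax :+ ay)) :- (e :+ σ :* (ax :* by :+ ay :* bx)) :=
             (ab :* ax) :+ (ab :* ay) :+ (ab :* d :- e) :- σ :* (ax :* by :+ ay :* bx))
             refl (δ a b) d (δ a x) (δ a y) (δ b x) (δ b y) e σ ⟩
      δ a b * δ a x + δ a b * δ a y + (δ a b * d - e) - σ * (δ a x * δ b y + δ a y * δ b x)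
        ≈⟨ +-congʳ (+-congʳ (+-cong (δ-transport a b x)
             (trans (δ-transport a b y) (sym (trans (*-congʳ (signValue² s)) (*-identityˡ _)))))) ⟩
      δ a x * δ b x + σ * σ * (δ a y * δ b y) + (δ a b * d - e) - σ * (δ a x * δ b y + δ a y * δ b x)
        ≈⟨ solve 6 (λ ax ay bx by l σ →
             ax :* bx :+ σ :* σ :* (ay :* by) :+ l :- σ :* (ax :* by :+ ay :* bx) :=
             l :+ (ax :- σ :* ay) :* (bx :- σ :* by))
             refl (δ a x) (δ a y) (δ b x) (δ b y) (δ a b * d - e) σ ⟩
      (δ a b * d - e) + incidence a * incidence b
        ≈⟨ +-congʳ (laplacian-entry Γ a b) ⟨
      L Γ a b + incidence a * incidence b ∎
      where
      d e σ : Carrier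
      d = sum λ z → adjacent (edge Γ a z)
      e = entry rawRing (edge Γ a b)
      σ = signValue s

  module _ {N} (z : Fin N) where

    switchSign : Fin N → Carrier
    switchSign x = if ⌊ x ≟ z ⌋ then - 1# else 1#

    switchMatrix : Matrix Carrier N
    switchMatrix x y = δ x y * switchSign y

    switchMatrix-⊛ : ∀ (M : Matrix Carrier N) i k → (switchMatrix ⊛ M) i k ≈ switchSign i * M i k
    switchMatrix-⊛ M i k = trans
      (sum-cong-≋ λ j → *-assoc (δ i j) (switchSign j) (M j k))
      (sum-δ i λ j → switchSign j * M j k)

    ⊛-switchMatrix : ∀ (M : Matrix Carrier N) i k → (M ⊛ switchMatrix) i k ≈ switchSign k * M i k
    ⊛-switchMatrix M i k = trans
      (sum-cong-≋ λ j → trans (*-congˡ (*-congʳ (δ-sym j k)))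
        (solve 3 (λ m d s → m :* (d :* s) := d :* (s :* m)) refl (M i j) (δ k j) (switchSign k)))
      (sum-δ k λ j → switchSign k * M i j)

    switchMatrix-involutive : switchMatrix ⊛ switchMatrix ≋ δ
    switchMatrix-involutive i k = trans (switchMatrix-⊛ switchMatrix i k) square
      where
      square : switchSign i * (δ i k * switchSign k) ≈ δ i k
      square with i ≟ k
      ... | no  _ = solve 2 (λ s t → s :* (:0 :* t) := :0) refl _ _
      square | yes ≡.refl with i ≟ z
      ... | yes _ = solve 0 (:- :1 :* (:1 :* :- :1) := :1) refl
      ... | no  _ = solve 0 (:1 :* (:1 :* :1) := :1) refl

    laplacian-switch : ∀ (Γ : SignedGraph N) x y →
                       L (switch z Γ) x y ≈ switchSign x * (switchSign y * L Γ x y)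
    laplacian-switch Γ x y = begin
      L (switch z Γ) x y
        ≈⟨ laplacian-entry (switch z Γ) x y ⟩
      δ x y * (sum λ w → adjacent (edge (switch z Γ) x w)) - entry rawRing (edge (switch z Γ) x y)
        ≈⟨ +-cong (*-congˡ (sum-cong-≋ λ w →
             reflexive (adjacent-flip (⌊ x ≟ z ⌋ xor ⌊ w ≟ z ⌋) (edge Γ x w)))) refl ⟩
      δ x y * d - entry rawRing (edge (switch z Γ) x y)
        ≈⟨ signs ⟩
      switchSign x * (switchSign y * (δ x y * d - entry rawRing (edge Γ x y)))
        ≈⟨ *-congˡ (*-congˡ (laplacian-entry Γ x y)) ⟨
      switchSign x * (switchSign y * L Γ x y) ∎
      where
      d : Carrier
      d = sum λ w → adjacent (edge Γ x w)

      adjacent-flip : ∀ b e → adjacent (flipIf b e) ≡ adjacent e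
      adjacent-flip false e        = ≡.refl
      adjacent-flip true  nothing  = ≡.refl
      adjacent-flip true  (just _) = ≡.refl

      entry-flip : ∀ e → entry rawRing (flipIf true e) ≈ - entry rawRing e
      entry-flip nothing       = sym -0#≈0#
      entry-flip (just Sign.+) = refl
      entry-flip (just Sign.-) = sym (-‿involutive 1#)

      signs : δ x y * d - entry rawRing (edge (switch z Γ) x y) ≈
              switchSign x * (switchSign y * (δ x y * d - entry rawRing (edge Γ x y)))
      signs with x ≟ y
      signs | yes ≡.refl with x ≟ z
      ... | yes _ = solve 2 (λ d e → :1 :* d :- e := :- :1 :* (:- :1 :* (:1 :* d :- e))) refl _ _
      ... | no  _ = solve 2 (λ d e → :1 :* d :- e := :1 :* (:1 :* (:1 :* d :- e))) refl _ _
      signs | no x≢y with x ≟ z | y ≟ z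
      ... | yes x≡z | yes y≡z = contradiction (≡.trans x≡z (≡.sym y≡z)) x≢y
      ... | yes _ | no _ = trans (+-congˡ (-‿cong (entry-flip (edge Γ x y))))
        (solve 2 (λ d e → :0 :* d :- (:- e) := :- :1 :* (:1 :* (:0 :* d :- e))) refl _ _)
      ... | no _ | yes _ = trans (+-congˡ (-‿cong (entry-flip (edge Γ x y))))
        (solve 2 (λ d e → :0 :* d :- (:- e) := :1 :* (:- :1 :* (:0 :* d :- e))) refl _ _)
      ... | no _ | no _ = solve 2 (λ d e → :0 :* d :- e := :1 :* (:1 :* (:0 :* d :- e))) refl _ _

    switch-intertwines : ∀ (Γ : SignedGraph N) → switchMatrix ⊛ L Γ ≋ L (switch z Γ) ⊛ switchMatrix
    switch-intertwines Γ x y = begin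
      (switchMatrix ⊛ L Γ) x y
        ≈⟨ switchMatrix-⊛ (L Γ) x y ⟩
      switchSign x * L Γ x y
        ≈⟨ *-congˡ (trans (*-congʳ square) (*-identityˡ _)) ⟨
      switchSign x * (switchSign y * switchSign y * L Γ x y)
        ≈⟨ solve 3 (λ s t l → s :* (t :* t :* l) := t :* (s :* (t :* l))) refl _ _ _ ⟩
      switchSign y * (switchSign x * (switchSign y * L Γ x y))
        ≈⟨ *-congˡ (laplacian-switch Γ x y) ⟨
      switchSign y * L (switch z Γ) x y
        ≈⟨ ⊛-switchMatrix (L (switch z Γ)) x y ⟨
      (L (switch z Γ) ⊛ switchMatrix) x y ∎
      where
      square : switchSign y * switchSign y ≈ 1#
      square with y ≟ z
      ... | yes _ = solve 0 (:- :1 :* :- :1 := :1) refl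
      ... | no  _ = *-identityˡ 1#

-- Paths and pairs of paths

isYes-⇔ : ∀ {a b} {A : Set a} {B : Set b} (A? : Dec A) (B? : Dec B) →
          (A → B) → (B → A) → ⌊ A? ⌋ ≡ ⌊ B? ⌋
isYes-⇔ (yes _) (yes _) f g = ≡.refl
isYes-⇔ (yes a) (no ¬b) f g = contradiction (f a) ¬b
isYes-⇔ (no ¬a) (yes b) f g = contradiction (g b) ¬a
isYes-⇔ (no _)  (no _)  f g = ≡.refl

opposite-toℕ : ∀ {n} (i : Fin n) → toℕ (opposite i) ℕ.+ suc (toℕ i) ≡ n
opposite-toℕ i = ≡.trans (≡.cong (ℕ._+ suc (toℕ i)) (opposite-prop i)) (ℕₚ.m∸n+n≡m (toℕ<n i))

opposite-successor : ∀ {n} (i j : Fin n) →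
                     suc (toℕ (opposite i)) ≡ toℕ (opposite j) → suc (toℕ j) ≡ toℕ i
opposite-successor i j eq = ℕₚ.+-cancelˡ-≡ (suc (toℕ (opposite i))) _ _ (begin
  suc (toℕ (opposite i)) ℕ.+ suc (toℕ j) ≡⟨ ≡.cong (ℕ._+ suc (toℕ j)) eq ⟩
  toℕ (opposite j) ℕ.+ suc (toℕ j)       ≡⟨ opposite-toℕ j ⟩
  _                                      ≡⟨ opposite-toℕ i ⟨
  toℕ (opposite i) ℕ.+ suc (toℕ i)       ≡⟨ ℕₚ.+-suc _ (toℕ i) ⟩
  suc (toℕ (opposite i)) ℕ.+ toℕ i       ∎)
  where open ≡.≡-Reasoning

-- Reversal exchanges the two successor tests in `pathEdge`, and symmetry of the path exchanges them
-- back.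
pathEdge-opposite : ∀ {n} (i j : Fin n) → pathEdge (opposite i) (opposite j) ≡ pathEdge i j
pathEdge-opposite i j = ≡.trans
  (≡.cong₂ (λ b c → if b ∨ c then just Sign.+ else nothing) (successor i j) (successor j i))
  (pathEdge-sym j i)
  where
  successor : ∀ i j → ⌊ suc (toℕ (opposite i)) ℕₚ.≟ toℕ (opposite j) ⌋ ≡ ⌊ suc (toℕ j) ℕₚ.≟ toℕ i ⌋
  successor i j = isYes-⇔ (_ ℕₚ.≟ _) (_ ℕₚ.≟ _) (opposite-successor i j) λ eq →
    opposite-successor (opposite j) (opposite i)
      (≡.subst₂ (λ x y → suc (toℕ x) ≡ toℕ y)
        (≡.sym (opposite-involutive j)) (≡.sym (opposite-involutive i)) eq)

pathGraph : ∀ n → SignedGraph n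
pathGraph n = record { edge = pathEdge ; edge-sym = pathEdge-sym ; edge-irrefl = pathEdge-irrefl }

data Side : Set where
  U V : Side

embed : ∀ {n} → Side → Fin n → Fin (n ℕ.+ n)
embed U = u
embed V = v

embed-elim : ∀ {ℓ} n (Q : Fin (n ℕ.+ n) → Set ℓ) → (∀ s (i : Fin n) → Q (embed s i)) → ∀ x → Q x
embed-elim n Q q x with splitAt n x | join-splitAt n n x
... | inj₁ i | eq = ≡.subst Q eq (q U i)
... | inj₂ i | eq = ≡.subst Q eq (q V i)

splitAt-u : ∀ {n} (i : Fin n) → splitAt n (u i) ≡ inj₁ i
splitAt-u {n} i = splitAt-↑ˡ n i n

splitAt-v : ∀ {n} (i : Fin n) → splitAt n (v i) ≡ inj₂ i
splitAt-v {n} i = splitAt-↑ʳ n n i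

v-injective : ∀ {n} {i j : Fin n} → v i ≡ v j → i ≡ j
v-injective {n} {i} {j} = ↑ʳ-injective n i j

≟-embed : ∀ {n} s (i j : Fin n) → ⌊ embed s i ≟ embed s j ⌋ ≡ ⌊ i ≟ j ⌋
≟-embed U i j = isYes-⇔ (u i ≟ u j) (i ≟ j) u-injective (≡.cong u)
≟-embed V i j = isYes-⇔ (v i ≟ v j) (i ≟ j) v-injective (≡.cong v)

≟-uv : ∀ {n} (i j : Fin n) → ⌊ u i ≟ v j ⌋ ≡ false
≟-uv i j with u i ≟ v j
... | yes eq = contradiction eq u≢v
... | no  _  = ≡.refl

≟-vu : ∀ {n} (i j : Fin n) → ⌊ v i ≟ u j ⌋ ≡ false
≟-vu i j with v i ≟ u j
... | yes eq = contradiction (≡.sym eq) u≢v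
... | no  _  = ≡.refl

diagonalEdge : ∀ {n} → Side → Side → Fin n → Fin n → Maybe Sign
diagonalEdge U U i j = pathEdge i j
diagonalEdge V V i j = pathEdge i j
diagonalEdge _ _ i j = nothing

edge-twoPaths : ∀ {n} s t (i j : Fin n) →
                edge (twoPaths n) (embed s i) (embed t j) ≡ diagonalEdge s t i j
edge-twoPaths U U i j rewrite splitAt-u i | splitAt-u j = ≡.refl
edge-twoPaths U V i j rewrite splitAt-u i | splitAt-v j = ≡.refl
edge-twoPaths V U i j rewrite splitAt-v i | splitAt-u j = ≡.refl
edge-twoPaths V V i j rewrite splitAt-v i | splitAt-v j = ≡.refl

-- Block form of matrices on two paths

data Corner : Set where
  initial final : Side → Corner

-- The matrix entries in block form.  In position (s, i), (t, j) they are polynomials in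
-- the entries T = T i j and T′ = T (opposite i) j of a matrix on Fin n and in the
-- indicators a = [i = first], b = [i = last], c = [j = first], d = [j = last]; reflecting
-- i swaps a with b and T with T′.  The operations are arbitrary so that the same formula
-- can be read in a ring and in the syntax of the ring solver.
module BlockForms {c ℓ} (A : RawRing c ℓ) where
  open RawRing A

  indicator : Corner → Side → Carrier → Carrier → Carrier
  indicator (initial U) U a b = a
  indicator (initial V) V a b = a
  indicator (final U)   U a b = b
  indicator (final V)   V a b = b
  indicator _           _ a b = 0#

  diagonalBlock : Side → Side → Carrier → Carrier
  diagonalBlock U U T = T
  diagonalBlock V V T = T
  diagonalBlock _ _ T = 0#

  incidence : Corner × Corner × Sign → Side → Carrier → Carrier → Carrier
  incidence (x , y , σ) s a b = indicator x s a b + - (entry A (just σ) * indicator y s a b)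

  block : List (Corner × Corner × Sign) → Side → Side → (T a b c d : Carrier) → Carrier
  block []       s t T a b c d = diagonalBlock s t T
  block (e ∷ es) s t T a b c d = block es s t T a b c d + incidence e s a b * incidence e t c d

  module _ (α β : Side → Side → Sign) where
    private
      ⟦_⟧ : Sign → Carrier
      ⟦ σ ⟧ = entry A (just σ)

    mixed : Side → Side → (T T′ : Carrier) → Carrier
    mixed s t T T′ = ⟦ α s t ⟧ * T + ⟦ β s t ⟧ * T′

    mixedSquare : Side → Side → (T T′ : Carrier) → Carrier
    mixedSquare s t T T′ = term U + term V
      where
      term : Side → Carrier
      term r = ⟦ α s r ⟧ * mixed r t T T′ + ⟦ β s r ⟧ * mixed r t T′ T

    -- The blocks of the products of the intertwiner with a Laplacian, on the left and on the right.
    -- In the first, `β` reflects the row index and swaps `a` with `b`; in the second it reflects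
    -- the column index and swaps `c` with `d`. Both reflections swap `T` with `T′`.
    mixedˡ mixedʳ : List (Corner × Corner × Sign) → Side → Side → (T T′ a b c d : Carrier) → Carrier
    mixedˡ es s t T T′ a b c d = term U + term V
      where
      term : Side → Carrier
      term r = ⟦ α s r ⟧ * block es r t T a b c d + ⟦ β s r ⟧ * block es r t T′ b a c d
    mixedʳ es s t T T′ a b c d = term U + term V
      where
      term : Side → Carrier
      term r = ⟦ α r t ⟧ * block es s r T a b c d + ⟦ β r t ⟧ * block es s r T′ a b d c

module TwoPathMatrices {c ℓ} (R : CommutativeRing c ℓ) where
  open CommutativeRing R hiding (zero)
  open SemiringSum semiring
  open Determinants R
  open LaplacianMatrices R
  open RingSolver R
  open BlockForms rawRing
  open SetoidReasoning setoid

  sum-split : ∀ m {n} (f : Fin (m ℕ.+ n) → Carrier) →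
              sum f ≈ (sum λ i → f (i ↑ˡ n)) + (sum λ i → f (m ↑ʳ i))
  sum-split zero    f = sym (+-identityˡ _)
  sum-split (suc m) f = trans (+-congˡ (sum-split m λ i → f (suc i))) (sym (+-assoc _ _ _))

  sum-embed : ∀ n (f : Fin (n ℕ.+ n) → Carrier) →
              sum f ≈ (sum λ (i : Fin n) → f (embed U i)) + (sum λ (i : Fin n) → f (embed V i))
  sum-embed n = sum-split n

  T : ∀ {n} → Matrix Carrier n
  T {n} = L (pathGraph n)

  δ-opposite : ∀ {n} (i j : Fin n) → δ (opposite i) j ≈ δ i (opposite j)
  δ-opposite i j = reflexive (≡.cong (if_then 1# else 0#)
    (isYes-⇔ (opposite i ≟ j) (i ≟ opposite j)
      (λ eq → ≡.trans (≡.sym (opposite-involutive i)) (≡.cong opposite eq))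
      (λ eq → ≡.trans (≡.cong opposite eq) (opposite-involutive j))))

  δ-opposite-opposite : ∀ {n} (i j : Fin n) → δ (opposite i) (opposite j) ≈ δ i j
  δ-opposite-opposite i j = trans (δ-opposite i (opposite j))
    (reflexive (≡.cong (δ i) (opposite-involutive j)))

  T-opposite-opposite : ∀ {n} (i j : Fin n) → T (opposite i) (opposite j) ≈ T i j
  T-opposite-opposite {n} i j = begin
    T (opposite i) (opposite j)
      ≈⟨ laplacian-entry (pathGraph n) (opposite i) (opposite j) ⟩
    δ (opposite i) (opposite j) * (sum λ k → adjacent (pathEdge (opposite i) k)) -
      entry rawRing (pathEdge (opposite i) (opposite j))
      ≈⟨ +-cong (*-cong (δ-opposite-opposite i j) (trans
           (∑-permute (λ k → adjacent (pathEdge (opposite i) k)) reverse)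
           (sum-cong-≋ λ k → reflexive (≡.cong adjacent (pathEdge-opposite i k)))))
           (-‿cong (reflexive (≡.cong (entry rawRing) (pathEdge-opposite i j)))) ⟩
    δ i j * (sum λ k → adjacent (pathEdge i k)) - entry rawRing (pathEdge i j)
      ≈⟨ laplacian-entry (pathGraph n) i j ⟨
    T i j ∎

  -- Commutation of the path Laplacian with `J`, entrywise. Because of it, reflecting the column
  -- produces no third value besides `T i j` and `T (opposite i) j`.
  T-opposite : ∀ {n} (i j : Fin n) → T (opposite i) j ≈ T i (opposite j)
  T-opposite i j = trans (reflexive (≡.cong (T (opposite i)) (≡.sym (opposite-involutive j))))
    (T-opposite-opposite i (opposite j))

  δ-embed : ∀ {n} s t (i j : Fin n) → δ (embed s i) (embed t j) ≈ diagonalBlock s t (δ i j)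
  δ-embed U U i j = reflexive (≡.cong (if_then 1# else 0#) (≟-embed U i j))
  δ-embed U V i j = reflexive (≡.cong (if_then 1# else 0#) (≟-uv i j))
  δ-embed V U i j = reflexive (≡.cong (if_then 1# else 0#) (≟-vu i j))
  δ-embed V V i j = reflexive (≡.cong (if_then 1# else 0#) (≟-embed V i j))

  laplacian-twoPaths : ∀ {n} s t (i j : Fin n) →
    L (twoPaths n) (embed s i) (embed t j) ≈ diagonalBlock s t (T i j)
  laplacian-twoPaths {n} s t i j = trans (laplacian-entry (twoPaths n) (embed s i) (embed t j))
    (trans (+-cong (*-cong (δ-embed s t i j) (degrees s))
                   (-‿cong (reflexive (≡.cong (entry rawRing) (edge-twoPaths s t i j)))))
           (blocks s t))
    where
    d : Carrier
    d = sum λ k → adjacent (pathEdge i k)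

    vanishing : (sum λ (k : Fin n) → 0#) ≈ 0#
    vanishing = sum-zero λ (k : Fin n) → refl

    degrees : ∀ s → (sum λ y → adjacent (edge (twoPaths n) (embed s i) y)) ≈ d
    degrees s = trans (sum-embed n λ y → adjacent (edge (twoPaths n) (embed s i) y)) (trans
      (+-cong (sum-cong-≋ λ (k : Fin n) → reflexive (≡.cong adjacent (edge-twoPaths s U i k)))
              (sum-cong-≋ λ (k : Fin n) → reflexive (≡.cong adjacent (edge-twoPaths s V i k))))
      (sides s))
      where
      sides : ∀ s →
        (sum λ k → adjacent (diagonalEdge s U i k)) +
        (sum λ k → adjacent (diagonalEdge s V i k)) ≈ d
      sides U = trans (+-congˡ vanishing) (+-identityʳ d)
      sides V = trans (+-congʳ vanishing) (+-identityˡ d)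

    blocks : ∀ s t → diagonalBlock s t (δ i j) * d - entry rawRing (diagonalEdge s t i j) ≈
      diagonalBlock s t (T i j)
    blocks U U = sym (laplacian-entry (pathGraph n) i j)
    blocks V V = sym (laplacian-entry (pathGraph n) i j)
    blocks U V = solve 1 (λ d → :0 :* d :- :0 := :0) refl d
    blocks V U = solve 1 (λ d → :0 :* d :- :0 := :0) refl d

coordinates : ∀ n → Fin (n ℕ.+ n) → Side × Fin n
coordinates n x = [ U ,_ , V ,_ ]′ (splitAt n x)

coordinates-embed : ∀ {n} s (i : Fin n) → coordinates n (embed s i) ≡ (s , i)
coordinates-embed U i rewrite splitAt-u i = ≡.refl
coordinates-embed V i rewrite splitAt-v i = ≡.refl

-- Intertwiners of the form α ⊗ I + β ⊗ J, where J is the reversal of the paths.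
module Mixing {c ℓ} (R : CommutativeRing c ℓ) (α β : Side → Side → Sign) where
  open CommutativeRing R hiding (zero)
  open SemiringSum semiring
  open Determinants R
  open LaplacianMatrices R using (signValue)
  open TwoPathMatrices R
  open RingSolver R
  open BlockForms rawRing
  open SetoidReasoning setoid

  mix : ∀ n → Matrix Carrier (n ℕ.+ n)
  mix n x y = entryAt (coordinates n x) (coordinates n y)
    where
    entryAt : Side × Fin n → Side × Fin n → Carrier
    entryAt (s , i) (t , j) = mixed α β s t (δ i j) (δ (opposite i) j)

  mix-embed : ∀ {n} s t (i j : Fin n) →
    mix n (embed s i) (embed t j) ≡ mixed α β s t (δ i j) (δ (opposite i) j)
  mix-embed s t i j rewrite coordinates-embed s i | coordinates-embed t j = ≡.refl

  module _ {n} (M : Matrix Carrier (n ℕ.+ n)) where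

    -- On each path a row of `mix` is supported at `i` and `opposite i`. The formula also holds when
    -- these coincide, as the two coefficients then add up.
    mix-⊛ : ∀ s (i : Fin n) y → let
      term = λ r → signValue (α s r) * M (embed r i) y + signValue (β s r) * M (embed r (opposite i)) y
      in (mix n ⊛ M) (embed s i) y ≈ term U + term V
    mix-⊛ s i y = trans (sum-embed n λ x → mix n (embed s i) x * M x y) (+-cong (half U) (half V))
      where
      half : ∀ r → (sum λ (k : Fin n) → mix n (embed s i) (embed r k) * M (embed r k) y) ≈
        signValue (α s r) * M (embed r i) y + signValue (β s r) * M (embed r (opposite i)) y
      half r = begin
        (sum λ (k : Fin n) → mix n (embed s i) (embed r k) * M (embed r k) y)
          ≈⟨ sum-cong-≋ (λ k → trans (*-congʳ (reflexive (mix-embed s r i k)))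
               (solve 5 (λ a b d e m → (a :* d :+ b :* e) :* m := d :* (a :* m) :+ e :* (b :* m))
                 refl A B (δ i k) (δ (opposite i) k) (M (embed r k) y))) ⟩
        (sum λ k → δ i k * (A * M (embed r k) y) + δ (opposite i) k * (B * M (embed r k) y))
          ≈⟨ ∑-distrib-+ (λ k → δ i k * (A * M (embed r k) y)) _ ⟩
        (sum λ k → δ i k * (A * M (embed r k) y)) +
          (sum λ k → δ (opposite i) k * (B * M (embed r k) y))
          ≈⟨ +-cong (sum-δ i λ k → A * M (embed r k) y)
                    (sum-δ (opposite i) λ k → B * M (embed r k) y) ⟩
        A * M (embed r i) y + B * M (embed r (opposite i)) y ∎
        where
        A B : Carrier
        A = signValue (α s r)
        B = signValue (β s r)

    ⊛-mix : ∀ x t (j : Fin n) → let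
      term = λ r → signValue (α r t) * M x (embed r j) + signValue (β r t) * M x (embed r (opposite j))
      in (M ⊛ mix n) x (embed t j) ≈ term U + term V
    ⊛-mix x t j = trans (sum-embed n λ y → M x y * mix n y (embed t j)) (+-cong (half U) (half V))
      where
      half : ∀ r → (sum λ (k : Fin n) → M x (embed r k) * mix n (embed r k) (embed t j)) ≈
        signValue (α r t) * M x (embed r j) + signValue (β r t) * M x (embed r (opposite j))
      half r = begin
        (sum λ (k : Fin n) → M x (embed r k) * mix n (embed r k) (embed t j))
          ≈⟨ sum-cong-≋ (λ k → trans (*-congˡ (trans (reflexive (mix-embed r t k j))
               (+-cong (*-congˡ (δ-sym k j))
                       (*-congˡ (trans (δ-opposite k j) (δ-sym k (opposite j)))))))
               (solve 5 (λ a b d e m → m :* (a :* d :+ b :* e) := d :* (a :* m) :+ e :* (b :* m))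
                 refl A B (δ j k) (δ (opposite j) k) (M x (embed r k)))) ⟩
        (sum λ k → δ j k * (A * M x (embed r k)) + δ (opposite j) k * (B * M x (embed r k)))
          ≈⟨ ∑-distrib-+ (λ k → δ j k * (A * M x (embed r k))) _ ⟩
        (sum λ k → δ j k * (A * M x (embed r k))) +
          (sum λ k → δ (opposite j) k * (B * M x (embed r k)))
          ≈⟨ +-cong (sum-δ j λ k → A * M x (embed r k))
                    (sum-δ (opposite j) λ k → B * M x (embed r k)) ⟩
        A * M x (embed r j) + B * M x (embed r (opposite j)) ∎
        where
        A B : Carrier
        A = signValue (α r t)
        B = signValue (β r t)

  diagonalBlock-cong : ∀ s t {T T′} → T ≈ T′ → diagonalBlock s t T ≈ diagonalBlock s t T′
  diagonalBlock-cong U U eq = eq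
  diagonalBlock-cong V V eq = eq
  diagonalBlock-cong U V eq = refl
  diagonalBlock-cong V U eq = refl

  indicator-cong : ∀ x s {a a′ b b′} → a ≈ a′ → b ≈ b′ → indicator x s a b ≈ indicator x s a′ b′
  indicator-cong (initial U) U a b = a
  indicator-cong (initial U) V a b = refl
  indicator-cong (initial V) U a b = refl
  indicator-cong (initial V) V a b = a
  indicator-cong (final U)   U a b = b
  indicator-cong (final U)   V a b = refl
  indicator-cong (final V)   U a b = refl
  indicator-cong (final V)   V a b = b

  incidence-cong : ∀ e s {a a′ b b′} → a ≈ a′ → b ≈ b′ → incidence e s a b ≈ incidence e s a′ b′
  incidence-cong (x , y , σ) s a b =
    +-cong (indicator-cong x s a b) (-‿cong (*-congˡ (indicator-cong y s a b)))

  block-cong : ∀ es s t {T T′ a a′ b b′ c c′ d d′} →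
    T ≈ T′ → a ≈ a′ → b ≈ b′ → c ≈ c′ → d ≈ d′ →
    block es s t T a b c d ≈ block es s t T′ a′ b′ c′ d′
  block-cong []       s t T a b c d = diagonalBlock-cong s t T
  block-cong (e ∷ es) s t T a b c d = +-cong (block-cong es s t T a b c d)
    (*-cong (incidence-cong e s a b) (incidence-cong e t c d))

  module _ {n} (f l : Fin n) (opposite-f : opposite f ≡ l) where

    HasBlocks : Matrix Carrier (n ℕ.+ n) → List (Corner × Corner × Sign) → Set ℓ
    HasBlocks M es = ∀ s t (i j : Fin n) →
      M (embed s i) (embed t j) ≈ block es s t (T i j) (δ i f) (δ i l) (δ j f) (δ j l)

    δ-f : ∀ i → δ (opposite i) f ≈ δ i l
    δ-f i = trans (δ-opposite i f) (reflexive (≡.cong (δ i) opposite-f))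

    δ-l : ∀ i → δ (opposite i) l ≈ δ i f
    δ-l i = trans (δ-opposite i l) (reflexive (≡.cong (δ i)
      (≡.trans (≡.cong opposite (≡.sym opposite-f)) (opposite-involutive f))))

    -- The size of the matrices disappears here: `identity` treats the two entries of `T` and the
    -- four corner indicators as independent variables, one equation for each pair of sides.
    mix-intertwines : ∀ {M M′ es es′} → HasBlocks M es → HasBlocks M′ es′ →
      (∀ s t T T′ a b c d → mixedˡ α β es s t T T′ a b c d ≈ mixedʳ α β es′ s t T T′ a b c d) →
      mix n ⊛ M ≋ M′ ⊛ mix n
    mix-intertwines {M} {M′} {es} {es′} blocks blocks′ identity =
      embed-elim n _ λ s i → embed-elim n _ λ t j → begin
        (mix n ⊛ M) (embed s i) (embed t j)
          ≈⟨ mix-⊛ M s i (embed t j) ⟩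
        _ ≈⟨ +-cong (left s t i j U) (left s t i j V) ⟩
        mixedˡ α β es s t (T i j) (T (opposite i) j) (δ i f) (δ i l) (δ j f) (δ j l)
          ≈⟨ identity s t _ _ _ _ _ _ ⟩
        mixedʳ α β es′ s t (T i j) (T (opposite i) j) (δ i f) (δ i l) (δ j f) (δ j l)
          ≈⟨ +-cong (right s t i j U) (right s t i j V) ⟨
        _ ≈⟨ ⊛-mix M′ (embed s i) t j ⟨
        (M′ ⊛ mix n) (embed s i) (embed t j) ∎
      where
      left : ∀ s t i j r →
        signValue (α s r) * M (embed r i) (embed t j) +
          signValue (β s r) * M (embed r (opposite i)) (embed t j) ≈
        signValue (α s r) * block es r t (T i j) (δ i f) (δ i l) (δ j f) (δ j l) +
          signValue (β s r) * block es r t (T (opposite i) j) (δ i l) (δ i f) (δ j f) (δ j l)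
      left s t i j r = +-cong (*-congˡ (blocks r t i j)) (*-congˡ (trans (blocks r t (opposite i) j)
        (block-cong es r t refl (δ-f i) (δ-l i) refl refl)))

      right : ∀ s t i j r →
        signValue (α r t) * M′ (embed s i) (embed r j) +
          signValue (β r t) * M′ (embed s i) (embed r (opposite j)) ≈
        signValue (α r t) * block es′ s r (T i j) (δ i f) (δ i l) (δ j f) (δ j l) +
          signValue (β r t) * block es′ s r (T (opposite i) j) (δ i f) (δ i l) (δ j l) (δ j f)
      right s t i j r = +-cong (*-congˡ (blocks′ s r i j)) (*-congˡ (trans (blocks′ s r i (opposite j))
        (block-cong es′ s r (sym (T-opposite i j)) refl refl (δ-f j) (δ-l j))))

  -- The involution is half of `mix`, so `mix` has square 4 and a quarter of it is its inverse.
  mix-inverse : ∀ q → q * (1# + 1# + 1# + 1#) ≈ 1# →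
    (∀ s t D D′ → mixedSquare α β s t D D′ ≈ (1# + 1# + 1# + 1#) * diagonalBlock s t D) →
    ∀ n → (λ x y → q * mix n x y) ⊛ mix n ≋ δ
  mix-inverse q q4≈1 square n = embed-elim n _ λ s i → embed-elim n _ λ t j → begin
    ((λ x y → q * mix n x y) ⊛ mix n) (embed s i) (embed t j)
      ≈⟨ sum-cong-≋ (λ k → *-assoc q (mix n (embed s i) k) (mix n k (embed t j))) ⟩
    (sum λ k → q * (mix n (embed s i) k * mix n k (embed t j)))
      ≈⟨ *-distribˡ-sum q (λ k → mix n (embed s i) k * mix n k (embed t j)) ⟨
    q * (mix n ⊛ mix n) (embed s i) (embed t j)
      ≈⟨ *-congˡ (mix-⊛ (mix n) s i (embed t j)) ⟩
    _ ≈⟨ *-congˡ (+-cong (term s t i j U) (term s t i j V)) ⟩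
    q * mixedSquare α β s t (δ i j) (δ (opposite i) j)
      ≈⟨ *-congˡ (square s t _ _) ⟩
    q * ((1# + 1# + 1# + 1#) * diagonalBlock s t (δ i j))
      ≈⟨ trans (sym (*-assoc _ _ _)) (trans (*-congʳ q4≈1) (*-identityˡ _)) ⟩
    diagonalBlock s t (δ i j)
      ≈⟨ δ-embed s t i j ⟨
    δ (embed s i) (embed t j) ∎
    where
    term : ∀ s t (i j : Fin n) r →
      signValue (α s r) * mix n (embed r i) (embed t j) +
        signValue (β s r) * mix n (embed r (opposite i)) (embed t j) ≈
      signValue (α s r) * mixed α β r t (δ i j) (δ (opposite i) j) +
        signValue (β s r) * mixed α β r t (δ (opposite i) j) (δ i j)
    term s t i j r = +-cong
      (*-congˡ (reflexive (mix-embed r t i j)))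
      (*-congˡ (trans (reflexive (mix-embed r t (opposite i) j))
        (+-congˡ (*-congˡ (reflexive (≡.cong (λ k → δ k j) (opposite-involutive i)))))))

isYes-refl : ∀ {n} (i : Fin n) → ⌊ i ≟ i ⌋ ≡ true
isYes-refl i with i ≟ i
... | yes _   = ≡.refl
... | no  i≢i = contradiction ≡.refl i≢i

isYes-≢ : ∀ {n} {i j : Fin n} → i ≢ j → ⌊ i ≟ j ⌋ ≡ false
isYes-≢ {i = i} {j} i≢j with i ≟ j
... | yes i≡j = contradiction i≡j i≢j
... | no  _   = ≡.refl

samePair-≢ : ∀ {N} {x y a b : Fin N} → b ≢ x → b ≢ y → samePair x y a b ≡ false
samePair-≢ {x = x} {y} {a} {b} b≢x b≢y
  rewrite isYes-≢ b≢x | isYes-≢ b≢y | ∧-zeroʳ ⌊ a ≟ x ⌋ = ∧-zeroʳ ⌊ a ≟ y ⌋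

addEdge-nothing : ∀ {N} (Γ : SignedGraph N) {x y} (x≢y : x ≢ y) s a b →
  edge Γ a b ≡ nothing → b ≢ x → b ≢ y → edge (addEdge Γ x y x≢y s) a b ≡ nothing
addEdge-nothing Γ x≢y s a b new b≢x b≢y =
  ≡.trans (≡.cong (if_then just s else edge Γ a b) (samePair-≢ {a = a} b≢x b≢y)) new

-- On a path with two vertices the ends are adjacent, and adding `u₁uₙ` would not create a new edge.
pathEdge-first-last : ∀ {n} (n≥3 : 3 ≤ n) → pathEdge (first n≥3) (last n≥3) ≡ nothing
pathEdge-first-last (s≤s (s≤s (s≤s _))) = ≡.refl

opposite-first : ∀ {n} (n≥3 : 3 ≤ n) → opposite (first n≥3) ≡ last n≥3
opposite-first (s≤s _) = ≡.refl

-- Both graphs consist of the two paths with the edges u₁uₙ, u₁v₁ and a third one, which is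
-- u₁vₙ in the bouquet of two cycles and uₙv₁ in the kite.
module _ {n : ℕ} (n≥3 : 3 ≤ n) (s₁ s₂ s₃ : Sign) where
  private
    twoEdges : SignedGraph (n ℕ.+ n)
    twoEdges = addEdge (addEdge (twoPaths n)
      (u₁ n≥3) (uₙ n≥3) (λ eq → first≢last n≥3 (u-injective eq)) s₁)
      (u₁ n≥3) (v₁ n≥3) u≢v s₂

  bouquet kite : SignedGraph (n ℕ.+ n)
  bouquet = addEdge twoEdges (u₁ n≥3) (vₙ n≥3) u≢v s₃
  kite    = addEdge twoEdges (uₙ n≥3) (v₁ n≥3) u≢v s₃

-- The edge added last comes first, following the nesting of `addEdge`.
bouquetEdges kiteEdges : Sign → Sign → Sign → List (Corner × Corner × Sign)
bouquetEdges s₁ s₂ s₃ =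
  (initial U , final V , s₃) ∷ (initial U , initial V , s₂) ∷ (initial U , final U , s₁) ∷ []
kiteEdges s₁ s₂ s₃ =
  (final U , initial V , s₃) ∷ (initial U , initial V , s₂) ∷ (initial U , final U , s₁) ∷ []

module CornerBlocks {c ℓ} (R : CommutativeRing c ℓ) {n : ℕ} (n≥3 : 3 ≤ n) where
  open CommutativeRing R hiding (zero)
  open Determinants R
  open LaplacianMatrices R
  open TwoPathMatrices R
  open BlockForms rawRing

  HasBlocks : SignedGraph (n ℕ.+ n) → List (Corner × Corner × Sign) → Set ℓ
  HasBlocks Γ es = ∀ s t (i j : Fin n) → L Γ (embed s i) (embed t j) ≈
    block es s t (T i j) (δ i (first n≥3)) (δ i (last n≥3)) (δ j (first n≥3)) (δ j (last n≥3))

  corner : Corner → Fin (n ℕ.+ n)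
  corner (initial s) = embed s (first n≥3)
  corner (final s)   = embed s (last n≥3)

  δ-corner : ∀ x s (i : Fin n) →
    δ (embed s i) (corner x) ≈ indicator x s (δ i (first n≥3)) (δ i (last n≥3))
  δ-corner (initial U) U i = δ-embed U U i _
  δ-corner (initial U) V i = δ-embed V U i _
  δ-corner (initial V) U i = δ-embed U V i _
  δ-corner (initial V) V i = δ-embed V V i _
  δ-corner (final U)   U i = δ-embed U U i _
  δ-corner (final U)   V i = δ-embed V U i _
  δ-corner (final V)   U i = δ-embed U V i _
  δ-corner (final V)   V i = δ-embed V V i _

  addEdge-blocks : ∀ Γ es x y σ (x≢y : corner x ≢ corner y) → edge Γ (corner x) (corner y) ≡ nothing →
    HasBlocks Γ es → HasBlocks (addEdge Γ (corner x) (corner y) x≢y σ) ((x , y , σ) ∷ es)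
  addEdge-blocks Γ es x y σ x≢y new blocks s t i j = trans
    (laplacian-addEdge Γ x≢y σ new (embed s i) (embed t j))
    (+-cong (blocks s t i j) (*-cong (incidences s i) (incidences t j)))
    where
    incidences : ∀ s (i : Fin n) →
      δ (embed s i) (corner x) - signValue σ * δ (embed s i) (corner y) ≈
      incidence (x , y , σ) s (δ i (first n≥3)) (δ i (last n≥3))
    incidences s i = +-cong (δ-corner x s i) (-‿cong (*-congˡ (δ-corner y s i)))

  module _ (s₁ s₂ s₃ : Sign) where
    private
      f l : Fin n
      f = first n≥3
      l = last n≥3

      v≢u : ∀ {i j : Fin n} → v i ≢ u j
      v≢u eq = u≢v (≡.sym eq)

      vₙ≢v₁ : vₙ n≥3 ≢ v₁ n≥3
      vₙ≢v₁ eq = first≢last n≥3 (≡.sym (v-injective eq))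

      uₙ≢u₁ : uₙ n≥3 ≢ u₁ n≥3
      uₙ≢u₁ eq = first≢last n≥3 (≡.sym (u-injective eq))

      u₁≢uₙ : u₁ n≥3 ≢ uₙ n≥3
      u₁≢uₙ eq = first≢last n≥3 (u-injective eq)

      oneEdge twoEdges : SignedGraph (n ℕ.+ n)
      oneEdge  = addEdge (twoPaths n) (u₁ n≥3) (uₙ n≥3) u₁≢uₙ s₁
      twoEdges = addEdge oneEdge (u₁ n≥3) (v₁ n≥3) u≢v s₂

      oneEdge-uv : ∀ (i j : Fin n) → edge oneEdge (u i) (v j) ≡ nothing
      oneEdge-uv i j = addEdge-nothing (twoPaths n) u₁≢uₙ s₁ (u i) (v j) (edge-twoPaths U V i j) v≢u v≢u

      oneList twoList : List (Corner × Corner × Sign)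
      oneList = (initial U , final U , s₁) ∷ []
      twoList = (initial U , initial V , s₂) ∷ oneList

      twoEdges-blocks : HasBlocks twoEdges twoList
      twoEdges-blocks = addEdge-blocks oneEdge oneList (initial U) (initial V) s₂ u≢v (oneEdge-uv f f)
        (addEdge-blocks (twoPaths n) [] (initial U) (final U) s₁ u₁≢uₙ
          (≡.trans (edge-twoPaths U U f l) (pathEdge-first-last n≥3)) laplacian-twoPaths)

    bouquet-blocks : HasBlocks (bouquet n≥3 s₁ s₂ s₃) (bouquetEdges s₁ s₂ s₃)
    bouquet-blocks = addEdge-blocks twoEdges twoList (initial U) (final V) s₃ u≢v
      (addEdge-nothing oneEdge u≢v s₂ (u f) (v l) (oneEdge-uv f l) v≢u vₙ≢v₁) twoEdges-blocks

    kite-blocks : HasBlocks (kite n≥3 s₁ s₂ s₃) (kiteEdges s₁ s₂ s₃)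
    kite-blocks = addEdge-blocks twoEdges twoList (final U) (initial V) s₃ u≢v
      -- `addEdge-nothing` wants its second vertex off the edge `u₁v₁`; `v₁` lies on that edge and
      -- `uₙ` does not, hence the reversal of the pair.
      (≡.trans (edge-sym twoEdges (uₙ n≥3) (v₁ n≥3)) (addEdge-nothing oneEdge u≢v s₂ (v f) (u l)
        (≡.trans (edge-sym oneEdge (v f) (u l)) (oneEdge-uv l f)) uₙ≢u₁ u≢v))
      twoEdges-blocks

-- The two intertwiners of bouquet and kite

module BouquetKite {c ℓ} (R : CommutativeRing c ℓ) where
  open CommutativeRing R hiding (zero)
  open LaplacianMatrices R
  open RingSolver R
  open BlockForms rawRing
  open PolynomialRing R using (_≈ₚ_; charPoly)
  open CharacteristicPolynomial R using (charPoly-conjugate)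
  private module S {n} = BlockForms (syntaxRing n)

  -- Split the functions on the two paths into their parts that are symmetric and
  -- antisymmetric under reversal.  Up to the factor 2, α₁ and β₁ exchange the symmetric
  -- parts on U and V and fix the antisymmetric ones, while α₂ and β₂ exchange the
  -- antisymmetric parts, fix the symmetric part on U and negate the one on V.
  α₁ β₁ α₂ β₂ : Side → Side → Sign
  α₁ _ _ = Sign.+
  β₁ U U = Sign.-
  β₁ U V = Sign.+
  β₁ V U = Sign.+
  β₁ V V = Sign.-
  α₂ V V = Sign.-
  α₂ _ _ = Sign.+
  β₂ U U = Sign.+
  β₂ _ _ = Sign.-

  square₁ : ∀ s t D D′ →
    mixedSquare α₁ β₁ s t D D′ ≈ (1# + 1# + 1# + 1#) * diagonalBlock s t D
  square₁ U U = solve 2 (λ D D′ → S.mixedSquare α₁ β₁ U U D D′ := (:1 :+ :1 :+ :1 :+ :1) :* D) refl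
  square₁ U V = solve 2 (λ D D′ → S.mixedSquare α₁ β₁ U V D D′ := (:1 :+ :1 :+ :1 :+ :1) :* :0) refl
  square₁ V U = solve 2 (λ D D′ → S.mixedSquare α₁ β₁ V U D D′ := (:1 :+ :1 :+ :1 :+ :1) :* :0) refl
  square₁ V V = solve 2 (λ D D′ → S.mixedSquare α₁ β₁ V V D D′ := (:1 :+ :1 :+ :1 :+ :1) :* D) refl

  square₂ : ∀ s t D D′ →
    mixedSquare α₂ β₂ s t D D′ ≈ (1# + 1# + 1# + 1#) * diagonalBlock s t D
  square₂ U U = solve 2 (λ D D′ → S.mixedSquare α₂ β₂ U U D D′ := (:1 :+ :1 :+ :1 :+ :1) :* D) refl
  square₂ U V = solve 2 (λ D D′ → S.mixedSquare α₂ β₂ U V D D′ := (:1 :+ :1 :+ :1 :+ :1) :* :0) refl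
  square₂ V U = solve 2 (λ D D′ → S.mixedSquare α₂ β₂ V U D D′ := (:1 :+ :1 :+ :1 :+ :1) :* :0) refl
  square₂ V V = solve 2 (λ D D′ → S.mixedSquare α₂ β₂ V V D D′ := (:1 :+ :1 :+ :1 :+ :1) :* D) refl

  intertwining₁ : ∀ s t T T′ a b c d →
    mixedˡ α₁ β₁ (bouquetEdges Sign.+ Sign.- Sign.+) s t T T′ a b c d ≈
    mixedʳ α₁ β₁ (kiteEdges Sign.+ Sign.- Sign.+) s t T T′ a b c d
  intertwining₁ U U = solve 6 (λ T T′ a b c d →
    S.mixedˡ α₁ β₁ (bouquetEdges Sign.+ Sign.- Sign.+) U U T T′ a b c d :=
    S.mixedʳ α₁ β₁ (kiteEdges Sign.+ Sign.- Sign.+) U U T T′ a b c d) refl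
  intertwining₁ U V = solve 6 (λ T T′ a b c d →
    S.mixedˡ α₁ β₁ (bouquetEdges Sign.+ Sign.- Sign.+) U V T T′ a b c d :=
    S.mixedʳ α₁ β₁ (kiteEdges Sign.+ Sign.- Sign.+) U V T T′ a b c d) refl
  intertwining₁ V U = solve 6 (λ T T′ a b c d →
    S.mixedˡ α₁ β₁ (bouquetEdges Sign.+ Sign.- Sign.+) V U T T′ a b c d :=
    S.mixedʳ α₁ β₁ (kiteEdges Sign.+ Sign.- Sign.+) V U T T′ a b c d) refl
  intertwining₁ V V = solve 6 (λ T T′ a b c d →
    S.mixedˡ α₁ β₁ (bouquetEdges Sign.+ Sign.- Sign.+) V V T T′ a b c d :=
    S.mixedʳ α₁ β₁ (kiteEdges Sign.+ Sign.- Sign.+) V V T T′ a b c d) refl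

  -- The signs are those found after switching at `uₙ`: `u₁uₙ` becomes negative in both graphs, and
  -- in the kite `uₙv₁` becomes negative as well.
  intertwining₂ : ∀ s t T T′ a b c d →
    mixedˡ α₂ β₂ (bouquetEdges Sign.- Sign.+ Sign.+) s t T T′ a b c d ≈
    mixedʳ α₂ β₂ (kiteEdges Sign.- Sign.- Sign.-) s t T T′ a b c d
  intertwining₂ U U = solve 6 (λ T T′ a b c d →
    S.mixedˡ α₂ β₂ (bouquetEdges Sign.- Sign.+ Sign.+) U U T T′ a b c d :=
    S.mixedʳ α₂ β₂ (kiteEdges Sign.- Sign.- Sign.-) U U T T′ a b c d) refl
  intertwining₂ U V = solve 6 (λ T T′ a b c d →
    S.mixedˡ α₂ β₂ (bouquetEdges Sign.- Sign.+ Sign.+) U V T T′ a b c d :=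
    S.mixedʳ α₂ β₂ (kiteEdges Sign.- Sign.- Sign.-) U V T T′ a b c d) refl
  intertwining₂ V U = solve 6 (λ T T′ a b c d →
    S.mixedˡ α₂ β₂ (bouquetEdges Sign.- Sign.+ Sign.+) V U T T′ a b c d :=
    S.mixedʳ α₂ β₂ (kiteEdges Sign.- Sign.- Sign.-) V U T T′ a b c d) refl
  intertwining₂ V V = solve 6 (λ T T′ a b c d →
    S.mixedˡ α₂ β₂ (bouquetEdges Sign.- Sign.+ Sign.+) V V T T′ a b c d :=
    S.mixedʳ α₂ β₂ (kiteEdges Sign.- Sign.- Sign.-) V V T T′ a b c d) refl

  module _ {q : Carrier} (q4≈1 : q * (1# + 1# + 1# + 1#) ≈ 1#) {n} (n≥3 : 3 ≤ n) where
    private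
      module C  = CornerBlocks R n≥3
      module M₁ = Mixing R α₁ β₁
      module M₂ = Mixing R α₂ β₂

    charPoly-bouquet-kite₁ : charPoly (L (bouquet n≥3 Sign.+ Sign.- Sign.+)) ≈ₚ
                             charPoly (L (kite n≥3 Sign.+ Sign.- Sign.+))
    charPoly-bouquet-kite₁ = charPoly-conjugate {P = M₁.mix n}
      {P⁻¹ = λ x y → q * M₁.mix n x y}
      {A = L (bouquet n≥3 Sign.+ Sign.- Sign.+)} {B = L (kite n≥3 Sign.+ Sign.- Sign.+)}
      (M₁.mix-inverse q q4≈1 square₁ n)
      (M₁.mix-intertwines (first n≥3) (last n≥3) (opposite-first n≥3)
        {es = bouquetEdges Sign.+ Sign.- Sign.+} {es′ = kiteEdges Sign.+ Sign.- Sign.+}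
        (C.bouquet-blocks _ _ _) (C.kite-blocks _ _ _) intertwining₁)

    charPoly-bouquet-kite₂ : charPoly (L (bouquet n≥3 Sign.- Sign.+ Sign.+)) ≈ₚ
                             charPoly (L (kite n≥3 Sign.- Sign.- Sign.-))
    charPoly-bouquet-kite₂ = charPoly-conjugate {P = M₂.mix n}
      {P⁻¹ = λ x y → q * M₂.mix n x y}
      {A = L (bouquet n≥3 Sign.- Sign.+ Sign.+)} {B = L (kite n≥3 Sign.- Sign.- Sign.-)}
      (M₂.mix-inverse q q4≈1 square₂ n)
      (M₂.mix-intertwines (first n≥3) (last n≥3) (opposite-first n≥3)
        {es = bouquetEdges Sign.- Sign.+ Sign.+} {es′ = kiteEdges Sign.- Sign.- Sign.-}
        (C.bouquet-blocks _ _ _) (C.kite-blocks _ _ _) intertwining₂)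

-- Identification of the given graphs with bouquets and kites

samePair-uu-uu : ∀ {n} (p q i j : Fin n) → samePair (u p) (u q) (u i) (u j) ≡ samePair p q i j
samePair-uu-uu p q i j
  rewrite ≟-embed U i p | ≟-embed U j q | ≟-embed U i q | ≟-embed U j p = ≡.refl

samePair-uu-uv : ∀ {n} (p q i j : Fin n) → samePair (u p) (u q) (u i) (v j) ≡ false
samePair-uu-uv p q i j = samePair-≢ {x = u p} {u q} {u i} {v j} (u≢v ∘ ≡.sym) (u≢v ∘ ≡.sym)

samePair-uu-vv : ∀ {n} (p q i j : Fin n) → samePair (u p) (u q) (v i) (v j) ≡ false
samePair-uu-vv p q i j = samePair-≢ {x = u p} {u q} {v i} {v j} (u≢v ∘ ≡.sym) (u≢v ∘ ≡.sym)

samePair-uv-uu : ∀ {n} (p q i j : Fin n) → samePair (u p) (v q) (u i) (u j) ≡ false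
samePair-uv-uu p q i j
  rewrite ≟-uv j q | ≟-uv i q | ∧-zeroʳ ⌊ u i ≟ u p ⌋ = ≡.refl

samePair-uv-uv : ∀ {n} (p q i j : Fin n) →
                 samePair (u p) (v q) (u i) (v j) ≡ ⌊ i ≟ p ⌋ ∧ ⌊ j ≟ q ⌋
samePair-uv-uv p q i j
  rewrite ≟-embed U i p | ≟-embed V j q | ≟-uv i q = ∨-identityʳ _

samePair-uv-vv : ∀ {n} (p q i j : Fin n) → samePair (u p) (v q) (v i) (v j) ≡ false
samePair-uv-vv p q i j
  rewrite ≟-vu i p | ≟-vu j p | ∧-zeroʳ ⌊ v i ≟ v q ⌋ = ≡.refl

edge-ext : ∀ {n} (Γ Δ : SignedGraph (n ℕ.+ n)) →
  (∀ (i j : Fin n) → edge Γ (u i) (u j) ≡ edge Δ (u i) (u j)) →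
  (∀ (i j : Fin n) → edge Γ (u i) (v j) ≡ edge Δ (u i) (v j)) →
  (∀ (i j : Fin n) → edge Γ (v i) (v j) ≡ edge Δ (v i) (v j)) →
  ∀ x y → edge Γ x y ≡ edge Δ x y
edge-ext {n} Γ Δ uu uv vv = embed-elim n _ λ s i → embed-elim n _ λ t j → blocks s t i j
  where
  blocks : ∀ s t (i j : Fin n) →
           edge Γ (embed s i) (embed t j) ≡ edge Δ (embed s i) (embed t j)
  blocks U U = uu
  blocks U V = uv
  blocks V V = vv
  blocks V U i j = ≡.trans (edge-sym Γ (v i) (u j)) (≡.trans (uv j i) (edge-sym Δ (u j) (v i)))

first≢penultimate : ∀ {n} (n≥3 : 3 ≤ n) → first n≥3 ≢ penultimate n≥3
first≢penultimate (s≤s (s≤s (s≤s _))) ()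

penultimate≢last : ∀ {n} (n≥3 : 3 ≤ n) → penultimate n≥3 ≢ last n≥3
penultimate≢last (s≤s (s≤s {n = m} _)) = fromℕ≢inject₁ ∘ ≡.sym

-- Determines which edges the switching at `uₙ` affects within the path, and why `vₙ` can be a leaf.
pathEdge-last : ∀ {n} (n≥3 : 3 ≤ n) j →
  pathEdge (last n≥3) j ≡ (if ⌊ j ≟ penultimate n≥3 ⌋ then just Sign.+ else nothing)
pathEdge-last (s≤s (s≤s {n = m} _)) j = ≡.cong (if_then just Sign.+ else nothing)
  (≡.cong₂ _∨_ beyond (isYes-⇔ (_ ℕₚ.≟ _) (j ≟ _)
    (λ eq → toℕ-injective (≡.trans (ℕₚ.suc-injective (≡.trans eq (toℕ-fromℕ (suc m)))) (≡.sym toℕ-penultimate)))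
    (λ { ≡.refl → ≡.trans (≡.cong suc toℕ-penultimate) (≡.sym (toℕ-fromℕ (suc m))) })))
  where
  toℕ-penultimate : toℕ (inject₁ (fromℕ m)) ≡ m
  toℕ-penultimate = ≡.trans (toℕ-inject₁ (fromℕ m)) (toℕ-fromℕ m)

  beyond : ⌊ suc (toℕ (fromℕ (suc m))) ℕₚ.≟ toℕ j ⌋ ≡ false
  beyond with suc (toℕ (fromℕ (suc m))) ℕₚ.≟ toℕ j
  ... | no  _  = ≡.refl
  ... | yes eq = contradiction
    (≡.subst (ℕ._< suc (suc m)) (≡.trans (≡.sym eq) (≡.cong suc (toℕ-fromℕ (suc m)))) (toℕ<n j))
    (ℕₚ.<-irrefl ≡.refl)

module _ {n : ℕ} (n≥3 : 3 ≤ n) where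
  private
    f p l : Fin n
    f = first n≥3
    p = penultimate n≥3
    l = last n≥3

  module _ (s₁ s₂ s₃ : Sign) where

    bouquet-uu : ∀ i j → edge (bouquet n≥3 s₁ s₂ s₃) (u i) (u j) ≡
                         (if samePair f l i j then just s₁ else pathEdge i j)
    bouquet-uu i j rewrite samePair-uv-uu f l i j | samePair-uv-uu f f i j
      | samePair-uu-uu f l i j | edge-twoPaths U U i j = ≡.refl

    bouquet-uv : ∀ i j → edge (bouquet n≥3 s₁ s₂ s₃) (u i) (v j) ≡
      (if ⌊ i ≟ f ⌋ ∧ ⌊ j ≟ l ⌋ then just s₃ else
       if ⌊ i ≟ f ⌋ ∧ ⌊ j ≟ f ⌋ then just s₂ else nothing)
    bouquet-uv i j rewrite samePair-uv-uv f l i j | samePair-uv-uv f f i j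
      | samePair-uu-uv f l i j | edge-twoPaths U V i j = ≡.refl

    bouquet-vv : ∀ i j → edge (bouquet n≥3 s₁ s₂ s₃) (v i) (v j) ≡ pathEdge i j
    bouquet-vv i j rewrite samePair-uv-vv f l i j | samePair-uv-vv f f i j
      | samePair-uu-vv f l i j | edge-twoPaths V V i j = ≡.refl

    kite-uu : ∀ i j → edge (kite n≥3 s₁ s₂ s₃) (u i) (u j) ≡
                      (if samePair f l i j then just s₁ else pathEdge i j)
    kite-uu i j rewrite samePair-uv-uu l f i j | samePair-uv-uu f f i j
      | samePair-uu-uu f l i j | edge-twoPaths U U i j = ≡.refl

    kite-uv : ∀ i j → edge (kite n≥3 s₁ s₂ s₃) (u i) (v j) ≡
      (if ⌊ i ≟ l ⌋ ∧ ⌊ j ≟ f ⌋ then just s₃ else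
       if ⌊ i ≟ f ⌋ ∧ ⌊ j ≟ f ⌋ then just s₂ else nothing)
    kite-uv i j rewrite samePair-uv-uv l f i j | samePair-uv-uv f f i j
      | samePair-uu-uv f l i j | edge-twoPaths U V i j = ≡.refl

    kite-vv : ∀ i j → edge (kite n≥3 s₁ s₂ s₃) (v i) (v j) ≡ pathEdge i j
    kite-vv i j rewrite samePair-uv-vv l f i j | samePair-uv-vv f f i j
      | samePair-uu-vv f l i j | edge-twoPaths V V i j = ≡.refl

  module _ (Γ : SignedGraph (n ℕ.+ n)) where

    transpose-uu : ∀ (i j : Fin n) → edge (partialTranspose n Γ) (u i) (u j) ≡ edge Γ (u i) (u j)
    transpose-uu i j rewrite splitAt-u i | splitAt-u j = ≡.refl

    transpose-uv : ∀ (i j : Fin n) → edge (partialTranspose n Γ) (u i) (v j) ≡ edge Γ (u j) (v i)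
    transpose-uv i j rewrite splitAt-u i | splitAt-v j = ≡.refl

    transpose-vv : ∀ (i j : Fin n) → edge (partialTranspose n Γ) (v i) (v j) ≡ edge Γ (v i) (v j)
    transpose-vv i j rewrite splitAt-v i | splitAt-v j = ≡.refl

  -- Transposition moves `u₁vₙ` to `uₙv₁` and fixes `u₁v₁`. In the cross block the roles of `i` and
  -- `j` are exchanged, so the conjunctions of the tests have to be commuted.
  Γ₁τ-kite : ∀ x y → edge (Γ₁τ n≥3) x y ≡ edge (kite n≥3 Sign.+ Sign.- Sign.+) x y
  Γ₁τ-kite = edge-ext (Γ₁τ n≥3) (kite n≥3 Sign.+ Sign.- Sign.+)
    (λ i j → ≡.trans (transpose-uu _ i j)
      (≡.trans (bouquet-uu _ _ _ i j) (≡.sym (kite-uu _ _ _ i j))))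
    (λ i j → ≡.trans (transpose-uv _ i j) (≡.trans (bouquet-uv _ _ _ j i) (≡.trans
      (≡.cong₂ (λ b c → if b then just Sign.+ else if c then just Sign.- else nothing)
        (∧-comm ⌊ j ≟ f ⌋ _) (∧-comm ⌊ j ≟ f ⌋ _)) (≡.sym (kite-uv _ _ _ i j)))))
    (λ i j → ≡.trans (transpose-vv _ i j)
      (≡.trans (bouquet-vv _ _ _ i j) (≡.sym (kite-vv _ _ _ i j))))

  private
    l≢f : l ≢ f
    l≢f = first≢last n≥3 ∘ ≡.sym

    l≢p : l ≢ p
    l≢p = penultimate≢last n≥3 ∘ ≡.sym

  -- The left-hand sides of the switched lemmas are edges of Γ₂ and Γ₃, switched at uₙ.
  switched-uu : ∀ i j → let e = if samePair f l i j then just Sign.+ else pathEdge i j in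
    flipIf (⌊ i ≟ l ⌋ xor ⌊ j ≟ l ⌋)
      (if samePair p l i j then Maybe.map (const Sign.-) e else e) ≡
    (if samePair f l i j then just Sign.- else pathEdge i j)
  switched-uu i j with i ≟ l | j ≟ l
  ... | no _ | no _ rewrite ∧-zeroʳ ⌊ i ≟ p ⌋ | ∧-zeroʳ ⌊ i ≟ f ⌋ = ≡.refl
  ... | yes ≡.refl | yes ≡.refl
    rewrite isYes-≢ l≢f | isYes-≢ l≢p | pathEdge-irrefl l = ≡.refl
  ... | yes ≡.refl | no _ rewrite isYes-≢ l≢f | isYes-≢ l≢p | pathEdge-last n≥3 j with j ≟ f | j ≟ p
  -- If `u₁` were `uₙ₋₁`, the path edge made negative and the added edge `u₁uₙ` would be the same
  -- edge.
  ...   | yes ≡.refl | yes f≡p = contradiction f≡p (first≢penultimate n≥3)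
  ...   | yes _ | no _  = ≡.refl
  ...   | no _  | yes _ = ≡.refl
  ...   | no _  | no _  = ≡.refl
  switched-uu i j | no _ | yes ≡.refl rewrite pathEdge-sym i l | pathEdge-last n≥3 i with i ≟ f | i ≟ p
  ...   | yes ≡.refl | yes f≡p = contradiction f≡p (first≢penultimate n≥3)
  ...   | yes _ | no _  = ≡.refl
  ...   | no _  | yes _ = ≡.refl
  ...   | no _  | no _  = ≡.refl

  switch-edge : ∀ {N} (Γ : SignedGraph N) z a b {p q e} →
    ⌊ a ≟ z ⌋ ≡ p → ⌊ b ≟ z ⌋ ≡ q → edge Γ a b ≡ e →
    edge (switch z Γ) a b ≡ flipIf (p xor q) e
  switch-edge Γ z a b ≡.refl ≡.refl ≡.refl = ≡.refl

  changeSign-edge : ∀ {N} (Γ : SignedGraph N) x y s a b {p e} →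
    samePair x y a b ≡ p → edge Γ a b ≡ e →
    edge (changeSign Γ x y s) a b ≡ (if p then Maybe.map (const s) e else e)
  changeSign-edge Γ x y s a b ≡.refl ≡.refl = ≡.refl

  switched-uv₂ : ∀ (i j : Fin n) → let
    e = if ⌊ i ≟ f ⌋ ∧ ⌊ j ≟ l ⌋ then just Sign.+ else
        if ⌊ i ≟ f ⌋ ∧ ⌊ j ≟ f ⌋ then just Sign.- else nothing in
    flipIf (⌊ i ≟ l ⌋ xor false)
      (if ⌊ i ≟ f ⌋ ∧ ⌊ j ≟ f ⌋ then Maybe.map (const Sign.+) e else e) ≡
    (if ⌊ i ≟ f ⌋ ∧ ⌊ j ≟ l ⌋ then just Sign.+ else
     if ⌊ i ≟ f ⌋ ∧ ⌊ j ≟ f ⌋ then just Sign.+ else nothing)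
  switched-uv₂ i j with i ≟ f
  ... | no _ = flipIf-nothing (⌊ i ≟ l ⌋ xor false)
  ... | yes ≡.refl rewrite isYes-≢ (first≢last n≥3) with j ≟ l | j ≟ f
  ...   | yes ≡.refl | yes l≡f = contradiction l≡f l≢f
  ...   | yes _ | no _  = ≡.refl
  ...   | no _  | yes _ = ≡.refl
  ...   | no _  | no _  = ≡.refl

  switched-uv₃ : ∀ (i j : Fin n) →
    flipIf (⌊ i ≟ l ⌋ xor false)
      (if ⌊ i ≟ l ⌋ ∧ ⌊ j ≟ f ⌋ then just Sign.+ else
       if ⌊ i ≟ f ⌋ ∧ ⌊ j ≟ f ⌋ then just Sign.- else nothing) ≡
    (if ⌊ i ≟ l ⌋ ∧ ⌊ j ≟ f ⌋ then just Sign.- else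
     if ⌊ i ≟ f ⌋ ∧ ⌊ j ≟ f ⌋ then just Sign.- else nothing)
  switched-uv₃ i j with i ≟ l
  ... | no _ = ≡.refl
  ... | yes ≡.refl rewrite isYes-≢ l≢f with j ≟ f
  ...   | yes _ = ≡.refl
  ...   | no  _ = ≡.refl

  private
    Γ₁⁻ : SignedGraph (n ℕ.+ n)
    Γ₁⁻ = changeSign (Γ₁ n≥3) (uₙ₋₁ n≥3) (uₙ n≥3) Sign.-

  switch-Γ₂ : ∀ x y → edge (switch (uₙ n≥3) (Γ₂ n≥3)) x y ≡
                      edge (bouquet n≥3 Sign.- Sign.+ Sign.+) x y
  switch-Γ₂ = edge-ext (switch (uₙ n≥3) (Γ₂ n≥3)) (bouquet n≥3 Sign.- Sign.+ Sign.+)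
    (λ i j → ≡.trans
      (switch-edge (Γ₂ n≥3) (u l) (u i) (u j) (≟-embed U i l) (≟-embed U j l)
        (changeSign-edge Γ₁⁻ (u f) (v f) Sign.+ (u i) (u j) (samePair-uv-uu f f i j)
          (changeSign-edge (Γ₁ n≥3) (u p) (u l) Sign.- (u i) (u j) (samePair-uu-uu p l i j)
            (bouquet-uu _ _ _ i j))))
      (≡.trans (switched-uu i j) (≡.sym (bouquet-uu _ _ _ i j))))
    (λ i j → ≡.trans
      (switch-edge (Γ₂ n≥3) (u l) (u i) (v j) (≟-embed U i l) (≟-vu j l)
        (changeSign-edge Γ₁⁻ (u f) (v f) Sign.+ (u i) (v j) (samePair-uv-uv f f i j)
          (changeSign-edge (Γ₁ n≥3) (u p) (u l) Sign.- (u i) (v j) (samePair-uu-uv p l i j)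
            (bouquet-uv _ _ _ i j))))
      (≡.trans (switched-uv₂ i j) (≡.sym (bouquet-uv _ _ _ i j))))
    (λ i j → ≡.trans
      (switch-edge (Γ₂ n≥3) (u l) (v i) (v j) (≟-vu i l) (≟-vu j l)
        (changeSign-edge Γ₁⁻ (u f) (v f) Sign.+ (v i) (v j) (samePair-uv-vv f f i j)
          (changeSign-edge (Γ₁ n≥3) (u p) (u l) Sign.- (v i) (v j) (samePair-uu-vv p l i j)
            (bouquet-vv _ _ _ i j))))
      (≡.sym (bouquet-vv _ _ _ i j)))

  switch-Γ₃ : ∀ x y → edge (switch (uₙ n≥3) (Γ₃ n≥3)) x y ≡
                      edge (kite n≥3 Sign.- Sign.- Sign.-) x y
  switch-Γ₃ = edge-ext (switch (uₙ n≥3) (Γ₃ n≥3)) (kite n≥3 Sign.- Sign.- Sign.-)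
    (λ i j → ≡.trans
      (switch-edge (Γ₃ n≥3) (u l) (u i) (u j) (≟-embed U i l) (≟-embed U j l)
        (changeSign-edge (Γ₁τ n≥3) (u p) (u l) Sign.- (u i) (u j) (samePair-uu-uu p l i j)
          (≡.trans (Γ₁τ-kite (u i) (u j)) (kite-uu _ _ _ i j))))
      (≡.trans (switched-uu i j) (≡.sym (kite-uu _ _ _ i j))))
    (λ i j → ≡.trans
      (switch-edge (Γ₃ n≥3) (u l) (u i) (v j) (≟-embed U i l) (≟-vu j l)
        (changeSign-edge (Γ₁τ n≥3) (u p) (u l) Sign.- (u i) (v j) (samePair-uu-uv p l i j)
          (≡.trans (Γ₁τ-kite (u i) (v j)) (kite-uv _ _ _ i j))))
      (≡.trans (switched-uv₃ i j) (≡.sym (kite-uv _ _ _ i j))))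
    (λ i j → ≡.trans
      (switch-edge (Γ₃ n≥3) (u l) (v i) (v j) (≟-vu i l) (≟-vu j l)
        (changeSign-edge (Γ₁τ n≥3) (u p) (u l) Sign.- (v i) (v j) (samePair-uu-vv p l i j)
          (≡.trans (Γ₁τ-kite (v i) (v j)) (kite-vv _ _ _ i j))))
      (≡.sym (kite-vv _ _ _ i j)))

-- Adjacency and non-isomorphism

Adjacent : ∀ {N} → SignedGraph N → Fin N → Fin N → Set
Adjacent Γ x y = is-just (edge Γ x y) ≡ true

-- Signs are forgotten, and degrees are compared without counting: two distinct neighbours of the
-- preimage of `x` would have distinct images, both adjacent to `x`.
≅-≢ : ∀ {M N} {Γ : SignedGraph M} {Δ : SignedGraph N} →
  (∀ x → ∃₂ λ y z → y ≢ z × Adjacent Γ x y × Adjacent Γ x z) →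
  (∃ λ x → ∀ y z → Adjacent Δ x y → Adjacent Δ x z → y ≡ z) →
  ¬ (Γ ≅ Δ)
≅-≢ {Γ = Γ} {Δ} two (x , unique) (π , preserves) with two (π ⟨$⟩ˡ x)
... | y , z , y≢z , x~y , x~z = y≢z (⟨$⟩ʳ-injective (unique _ _ (image x~y) (image x~z)))
  where
  image : ∀ {w} → Adjacent Γ (π ⟨$⟩ˡ x) w → Adjacent Δ x (π ⟨$⟩ʳ w)
  image {w} x~w = ≡.trans (≡.cong (λ t → is-just (edge Δ t (π ⟨$⟩ʳ w))) (≡.sym (inverseʳ π)))
    (≡.trans (≡.cong is-just (preserves _ w)) x~w)

  ⟨$⟩ʳ-injective : ∀ {y z} → π ⟨$⟩ʳ y ≡ π ⟨$⟩ʳ z → y ≡ z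
  ⟨$⟩ʳ-injective eq =
    ≡.trans (≡.sym (inverseˡ π)) (≡.trans (≡.cong (π ⟨$⟩ˡ_) eq) (inverseˡ π))

adjacent-changeSign : ∀ {N} (Γ : SignedGraph N) x y s a b →
  is-just (edge (changeSign Γ x y s) a b) ≡ is-just (edge Γ a b)
adjacent-changeSign Γ x y s a b with samePair x y a b | edge Γ a b
... | true  | just _  = ≡.refl
... | true  | nothing = ≡.refl
... | false | _       = ≡.refl

adjacent-addEdge : ∀ {N} (Γ : SignedGraph N) {x y} (x≢y : x ≢ y) s a b →
  Adjacent Γ a b → Adjacent (addEdge Γ x y x≢y s) a b
adjacent-addEdge Γ {x} {y} x≢y s a b a~b with samePair x y a b
... | true  = ≡.refl
... | false = a~b

adjacent-new : ∀ {N} (Γ : SignedGraph N) {x y} (x≢y : x ≢ y) s → Adjacent (addEdge Γ x y x≢y s) x y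
adjacent-new Γ {x} {y} x≢y s rewrite isYes-refl x | isYes-refl y = ≡.refl

adjacent-sym : ∀ {N} (Γ : SignedGraph N) x y → Adjacent Γ x y → Adjacent Γ y x
adjacent-sym Γ x y x~y = ≡.trans (≡.cong is-just (edge-sym Γ y x)) x~y

pathEdge-successor : ∀ {n} {i j : Fin n} → suc (toℕ i) ≡ toℕ j → is-just (pathEdge i j) ≡ true
pathEdge-successor {i = i} {j} eq with suc (toℕ i) ℕₚ.≟ toℕ j
... | yes _  = ≡.refl
... | no neq = contradiction eq neq

successor-or-last : ∀ {n} (n≥3 : 3 ≤ n) (i : Fin n) →
                    i ≡ last n≥3 ⊎ ∃ λ (j : Fin n) → suc (toℕ i) ≡ toℕ j
successor-or-last (s≤s {n = m} _) i with suc (toℕ i) ℕₚ.<? suc m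
... | yes i+1<n = inj₂ (fromℕ< i+1<n , ≡.sym (toℕ-fromℕ< i+1<n))
... | no  i+1≮n = inj₁ (toℕ-injective (≡.trans
  (ℕₚ.≤-antisym (ℕₚ.≤-pred (toℕ<n i)) (ℕₚ.≤-pred (ℕₚ.≮⇒≥ i+1≮n))) (≡.sym (toℕ-fromℕ m))))

predecessor-or-first : ∀ {n} (n≥3 : 3 ≤ n) (i : Fin n) →
                       i ≡ first n≥3 ⊎ ∃ λ (j : Fin n) → suc (toℕ j) ≡ toℕ i
predecessor-or-first (s≤s _) zero    = inj₁ ≡.refl
predecessor-or-first (s≤s _) (suc i) = inj₂ (inject₁ i , ≡.cong suc (toℕ-inject₁ i))

module _ {n : ℕ} (n≥3 : 3 ≤ n) where
  private
    f l : Fin n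
    f = first n≥3
    l = last n≥3

    Γ : SignedGraph (n ℕ.+ n)
    Γ = Γ₁ n≥3

    path-adjacent : ∀ s {i j : Fin n} → suc (toℕ i) ≡ toℕ j → Adjacent Γ (embed s i) (embed s j)
    path-adjacent U {i} {j} eq rewrite bouquet-uu n≥3 Sign.+ Sign.- Sign.+ i j
      with samePair f l i j
    ... | true  = ≡.refl
    ... | false = pathEdge-successor eq
    path-adjacent V {i} {j} eq rewrite bouquet-vv n≥3 Sign.+ Sign.- Sign.+ i j =
      pathEdge-successor eq

    u₁≢uₙ : u₁ n≥3 ≢ uₙ n≥3
    u₁≢uₙ eq = first≢last n≥3 (u-injective eq)

    Γ′ Γ″ : SignedGraph (n ℕ.+ n)
    Γ′ = addEdge (twoPaths n) (u f) (u l) u₁≢uₙ Sign.+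
    Γ″ = addEdge Γ′ (u f) (v f) u≢v Sign.-

    u₁~uₙ : Adjacent Γ (u f) (u l)
    u₁~uₙ = adjacent-addEdge Γ″ {u f} {v l} u≢v Sign.+ (u f) (u l)
      (adjacent-addEdge Γ′ {u f} {v f} u≢v Sign.- (u f) (u l)
        (adjacent-new (twoPaths n) u₁≢uₙ Sign.+))

    u₁~v₁ : Adjacent Γ (u f) (v f)
    u₁~v₁ = adjacent-addEdge Γ″ {u f} {v l} u≢v Sign.+ (u f) (v f)
      (adjacent-new Γ′ {u f} {v f} u≢v Sign.-)

    u₁~vₙ : Adjacent Γ (u f) (v l)
    u₁~vₙ = adjacent-new Γ″ {u f} {v l} u≢v Sign.+

    path-adjacent⁻ : ∀ s {i j : Fin n} → suc (toℕ i) ≡ toℕ j → Adjacent Γ (embed s j) (embed s i)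
    path-adjacent⁻ s {i} {j} eq = adjacent-sym Γ (embed s i) (embed s j) (path-adjacent s eq)

    TwoNeighbours : Fin (n ℕ.+ n) → Set
    TwoNeighbours x = ∃₂ λ y z → y ≢ z × Adjacent Γ x y × Adjacent Γ x z

    -- Keeps the two neighbours `uₙ₋₁` and `u₁` of `uₙ` distinct, which would fail on a path with
    -- two vertices.
    predecessor≢first : ∀ {k} → suc (toℕ k) ≡ toℕ l → k ≢ f
    predecessor≢first = lemma n≥3
      where
      lemma : ∀ {n} (n≥3 : 3 ≤ n) {k} → suc (toℕ k) ≡ toℕ (last n≥3) → k ≢ first n≥3
      lemma (s≤s (s≤s (s≤s _))) () ≡.refl

    predecessor≢successor : ∀ {i j k : Fin n} → suc (toℕ j) ≡ toℕ i → suc (toℕ i) ≡ toℕ k → j ≢ k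
    predecessor≢successor {i} {j} j<i i<k ≡.refl =
      ℕₚ.<-asym (ℕₚ.≤-reflexive j<i) (ℕₚ.≤-reflexive i<k)

  Γ₁-neighbours : ∀ x → TwoNeighbours x
  Γ₁-neighbours = embed-elim n _ neighbours
    where
    neighbours : ∀ s (i : Fin n) → TwoNeighbours (embed s i)
    neighbours U i with predecessor-or-first n≥3 i | successor-or-last n≥3 i
    ... | inj₁ ≡.refl | _ = u l , v l , u≢v , u₁~uₙ , u₁~vₙ
    ... | inj₂ (j , j<i) | inj₁ ≡.refl =
      u j , u f , predecessor≢first j<i ∘ u-injective ,
      path-adjacent⁻ U j<i , adjacent-sym Γ (u f) (u l) u₁~uₙ
    ... | inj₂ (j , j<i) | inj₂ (k , i<k) =
      u j , u k , predecessor≢successor j<i i<k ∘ u-injective ,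
      path-adjacent⁻ U j<i , path-adjacent U i<k
    neighbours V i with predecessor-or-first n≥3 i | successor-or-last n≥3 i
    ... | inj₁ ≡.refl | inj₁ f≡l = contradiction f≡l (first≢last n≥3)
    ... | inj₁ ≡.refl | inj₂ (k , i<k) =
      u f , v k , u≢v , adjacent-sym Γ (u f) (v f) u₁~v₁ , path-adjacent V i<k
    ... | inj₂ (j , j<i) | inj₁ ≡.refl =
      u f , v j , u≢v , adjacent-sym Γ (u f) (v l) u₁~vₙ , path-adjacent⁻ V j<i
    ... | inj₂ (j , j<i) | inj₂ (k , i<k) =
      v j , v k , predecessor≢successor j<i i<k ∘ v-injective ,
      path-adjacent⁻ V j<i , path-adjacent V i<k

  Γ₁τ-leaf : ∀ x y → Adjacent (Γ₁τ n≥3) (v l) x → Adjacent (Γ₁τ n≥3) (v l) y → x ≡ y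
  Γ₁τ-leaf x y vₙ~x vₙ~y = ≡.trans (neighbour x vₙ~x) (≡.sym (neighbour y vₙ~y))
    where
    p : Fin n
    p = penultimate n≥3

    neighbour : ∀ x → Adjacent (Γ₁τ n≥3) (v l) x → x ≡ v p
    neighbour = embed-elim n _ at
      where
      at : ∀ s (j : Fin n) → Adjacent (Γ₁τ n≥3) (v l) (embed s j) → embed s j ≡ v p
      -- Both cross edges of the kite end in `v₁`, so both tests fail at `vₙ`.
      at U j vₙ~x rewrite edge-sym (Γ₁τ n≥3) (v l) (u j) | Γ₁τ-kite n≥3 (u j) (v l)
        | kite-uv n≥3 Sign.+ Sign.- Sign.+ j l | isYes-≢ (first≢last n≥3 ∘ ≡.sym)
        | ∧-zeroʳ ⌊ j ≟ l ⌋ | ∧-zeroʳ ⌊ j ≟ f ⌋ with () ← vₙ~x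
      at V j vₙ~x rewrite Γ₁τ-kite n≥3 (v l) (v j) | kite-vv n≥3 Sign.+ Sign.- Sign.+ l j
        | pathEdge-last n≥3 j with j ≟ p | vₙ~x
      ... | yes j≡p | _ = ≡.cong v j≡p
      ... | no _ | ()

  Γ₁≇Γ₁τ : ¬ (Γ₁ n≥3 ≅ Γ₁τ n≥3)
  Γ₁≇Γ₁τ = ≅-≢ {Γ = Γ₁ n≥3} {Γ₁τ n≥3} Γ₁-neighbours (v l , Γ₁τ-leaf)

  Γ₂≇Γ₃ : ¬ (Γ₂ n≥3 ≅ Γ₃ n≥3)
  Γ₂≇Γ₃ = ≅-≢ {Γ = Γ₂ n≥3} {Γ₃ n≥3}
    (λ x → let y , z , y≢z , x~y , x~z = Γ₁-neighbours x in
           y , z , y≢z , ≡.trans (signs₂ x y) x~y , ≡.trans (signs₂ x z) x~z)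
    (v l , λ y z x~y x~z → Γ₁τ-leaf y z
      (≡.trans (≡.sym (signs₃ (v l) y)) x~y) (≡.trans (≡.sym (signs₃ (v l) z)) x~z))
    where
    Γ₁⁻ : SignedGraph (n ℕ.+ n)
    Γ₁⁻ = changeSign Γ (uₙ₋₁ n≥3) (uₙ n≥3) Sign.-

    signs₂ : ∀ x y → is-just (edge (Γ₂ n≥3) x y) ≡ is-just (edge Γ x y)
    signs₂ x y = ≡.trans (adjacent-changeSign Γ₁⁻ (u₁ n≥3) (v₁ n≥3) Sign.+ x y)
      (adjacent-changeSign Γ (uₙ₋₁ n≥3) (uₙ n≥3) Sign.- x y)

    signs₃ : ∀ x y → is-just (edge (Γ₃ n≥3) x y) ≡ is-just (edge (Γ₁τ n≥3) x y)
    signs₃ = adjacent-changeSign (Γ₁τ n≥3) (uₙ₋₁ n≥3) (uₙ n≥3) Sign.-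

-- Spectra over fields of characteristic zero

module Spectra (K : HeytingField 0ℓ 0ℓ 0ℓ) (char-0 : CharacteristicZero K) where
  R : CommutativeRing 0ℓ 0ℓ
  R = HeytingCommutativeRing.commutativeRing (HeytingField.heytingCommutativeRing K)

  open CommutativeRing R hiding (zero)
  open RingSolver R
  open LaplacianMatrices R
  open PolynomialRing R using (_≈ₚ_; charPoly; polynomialRing)
  open CharacteristicPolynomial R using (charPoly-conjugate; charPoly-cong)
  open BouquetKite R
  private module P = CommutativeRing polynomialRing

  charPoly⇒SameSpectrum : ∀ {M N} {A : Matrix Carrier M} {B : Matrix Carrier N} →
                          charPoly A ≈ₚ charPoly B → SameSpectrum K A B
  charPoly⇒SameSpectrum A≈B a k = mk⇔
    (λ (q , factors , q≉0) → q , (λ i → trans (sym (A≈B i)) (factors i)) , q≉0)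
    (λ (q , factors , q≉0) → q , (λ i → trans (A≈B i) (factors i)) , q≉0)

  quarter : ∃ λ q → q * (1# + 1# + 1# + 1#) ≈ 1#
  -- `CharacteristicZero` is indexed by the predecessor, so `3` makes `4 · 1#` apart from `0#`; what
  -- gets inverted is their difference, hence the subtraction of `:0` below.
  quarter with HeytingField.#⇒invertible K (char-0 3)
  ... | q , q4≈1 , _ = q , trans
    (solve 1 (λ q → q :* (:1 :+ :1 :+ :1 :+ :1) :=
                    q :* ((:1 :+ (:1 :+ (:1 :+ (:1 :+ :0)))) :- :0)) refl q) q4≈1

  charPoly-laplacian : ∀ {N} {Γ Δ : SignedGraph N} → (∀ x y → edge Γ x y ≡ edge Δ x y) →
                       charPoly (L Γ) ≈ₚ charPoly (L Δ)
  charPoly-laplacian {Γ = Γ} {Δ} Γ≗Δ =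
    charPoly-cong {A = L Γ} {B = L Δ} (laplacian-cong {Γ = Γ} {Δ} Γ≗Δ)

  charPoly-switch : ∀ {N} (z : Fin N) (Γ : SignedGraph N) →
                    charPoly (L Γ) ≈ₚ charPoly (L (switch z Γ))
  charPoly-switch z Γ = charPoly-conjugate
    {P = switchMatrix z} {P⁻¹ = switchMatrix z} {A = L Γ} {B = L (switch z Γ)}
    (switchMatrix-involutive z) (switch-intertwines z Γ)

  module _ {n} (n≥3 : 3 ≤ n) where

    Γ₁-cospectral : SameSpectrum K (L (Γ₁ n≥3)) (L (Γ₁τ n≥3))
    Γ₁-cospectral = charPoly⇒SameSpectrum {A = L (Γ₁ n≥3)} {L (Γ₁τ n≥3)} λ i → trans
      (charPoly-bouquet-kite₁ (proj₂ quarter) n≥3 i)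
      (sym (charPoly-laplacian {Γ = Γ₁τ n≥3} {kite n≥3 Sign.+ Sign.- Sign.+} (Γ₁τ-kite n≥3) i))

    Γ₂-cospectral : SameSpectrum K (L (Γ₂ n≥3)) (L (Γ₃ n≥3))
    Γ₂-cospectral = charPoly⇒SameSpectrum {A = L (Γ₂ n≥3)} {L (Γ₃ n≥3)} λ i →
      trans (charPoly-switch (uₙ n≥3) (Γ₂ n≥3) i)
      (trans (charPoly-laplacian {Γ = switch (uₙ n≥3) (Γ₂ n≥3)} {bouquet n≥3 Sign.- Sign.+ Sign.+} (switch-Γ₂ n≥3) i)
      (trans (charPoly-bouquet-kite₂ (proj₂ quarter) n≥3 i)
      (trans (sym (charPoly-laplacian {Γ = switch (uₙ n≥3) (Γ₃ n≥3)} {kite n≥3 Sign.- Sign.- Sign.-} (switch-Γ₃ n≥3) i))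
             (sym (charPoly-switch (uₙ n≥3) (Γ₃ n≥3) i)))))

theorem3p1 : (n : ℕ) (n≥3 : 3 ≤ n) →
    (¬ (Γ₁ n≥3 ≅ partialTranspose n (Γ₁ n≥3)) × LaplacianCospectral (Γ₁ n≥3) (partialTranspose n (Γ₁ n≥3)))
    × (¬ (Γ₂ n≥3 ≅ Γ₃ n≥3) × LaplacianCospectral (Γ₂ n≥3) (Γ₃ n≥3))
theorem3p1 n n≥3 =
  (Γ₁≇Γ₁τ n≥3 , λ K char-0 → Spectra.Γ₁-cospectral K char-0 n≥3) ,
  (Γ₂≇Γ₃ n≥3 , λ K char-0 → Spectra.Γ₂-cospectral K char-0 n≥3)
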